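{- For every fixed constant $q\ge 1$, the Generalized Multiway Cut on Trees (GMWCT) problem restricted to instances with exactly $q$ terminal sets can be solved in linear time; that is, there is an algorithm that, given an instance $(T,\{S_1,\ldots,S_q\},k)$ of GMWCT with $n=|V(T)|$, correctly decides whether it is a yes-instance in time $O(n)$, where the constant hidden in the $O$-notation may depend on $q$ (but not on $n$ or $k$).
   Context: Generalized Multiway Cut on Trees (GMWCT). Given: a tree $T$ (a finite connected acyclic undirected graph), a collection of vertex subsets (terminal sets) $S_1,\ldots,S_q\subseteq V(T)$, and a non-negative integer $k$. Question: is there a set $E'\subseteq E(T)$ with $|E'|\le k$ such that for every $i=1,\ldots,q$ and every pair of distinct vertices $u,v\in S_i$ there is no path between $u$ and $v$ in the graph $T-E'=(V(T),E(T)\setminus E')$? An instance is a yes-instance if the answer is yes. Running time is measured in the usual unit-cost model, in which arithmetic operations and comparisons on the numbers involved take constant time. -}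

module Defs where

open import Data.Bool.Base using (Bool; true; false; if_then_else_)
open import Data.Fin.Base using (Fin; toℕ)
open import Data.Fin.Subset using (Subset; _∈_; _∉_; ∣_∣)
open import Data.List.Base using (List; []; _∷_; _++_; length; head; last; concat; tabulate)
open import Data.List.Relation.Unary.Linked using (Linked)
open import Data.List.Relation.Unary.Unique.Propositional using (Unique)
open import Data.Maybe.Base using (just)
open import Data.Nat.Base using (ℕ; zero; suc; _+_; _∸_; _≤_; _<ᵇ_; _≡ᵇ_)
open import Data.Product.Base using (Σ; ∃; _×_; _,_; proj₁; proj₂)
open import Data.Sum.Base using (_⊎_)
open import Data.Vec.Base using (toList)
import Data.List.Base as List
open import Level using (0ℓ)
open import Relation.Binary.Core using (Rel)
open import Relation.Binary.PropositionalEquality.Core using (_≡_; _≢_)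
open import Relation.Nullary.Negation.Core using (¬_)

------------------------------------------------------------------------
-- Finite simple graphs and trees

-- The edges are numbered by Fin size, so that a set of edges is a
-- Subset size.  Each edge is undirected: `ends e` lists its two endpoints
-- in an arbitrary order.
record Graph (n : ℕ) : Set where
  field
    size : ℕ
    ends : Fin size → Fin n × Fin n

  Joins : Fin size → Rel (Fin n) 0ℓ
  Joins e u v = ends e ≡ (u , v) ⊎ ends e ≡ (v , u)

  field
    loopless    : ∀ {e u} → ¬ Joins e u u
    no-parallel : ∀ {e f u v} → Joins e u v → Joins f u v → e ≡ f

  Adjacent : Rel (Fin n) 0ℓ
  Adjacent u v = ∃ λ e → Joins e u v

  -- Adjacency in the graph obtained by deleting the edges in E′ and keeping
  -- every vertex.
  AdjacentWithout : Subset size → Rel (Fin n) 0ℓ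
  AdjacentWithout E′ u v = ∃ λ e → e ∉ E′ × Joins e u v

-- vs is the vertex sequence of a path from u to v.
record IsPath {n} (_~_ : Rel (Fin n) 0ℓ) (u v : Fin n) (vs : List (Fin n)) : Set where
  field
    linked   : Linked _~_ vs
    distinct : Unique vs
    starts   : head vs ≡ just u
    finishes : last vs ≡ just v

Connected : ∀ {n} → Rel (Fin n) 0ℓ → Set
Connected _~_ = ∀ u v → ∃ λ vs → IsPath _~_ u v vs

-- A cycle is a path on at least three vertices whose last vertex is
-- adjacent to its first one.
Acyclic : ∀ {n} → Rel (Fin n) 0ℓ → Set
Acyclic _~_ = ∀ {u v vs} → IsPath _~_ u v vs → 3 ≤ length vs → ¬ (v ~ u)

record IsTree {n} (G : Graph n) : Set where
  open Graph G
  field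
    nonempty  : 1 ≤ n
    connected : Connected Adjacent
    acyclic   : Acyclic Adjacent

------------------------------------------------------------------------
-- Generalized Multiway Cut on Trees

record GMWCT (q n : ℕ) : Set where
  field
    T      : Graph n
    isTree : IsTree T
    S      : Fin q → Subset n
    k      : ℕ
  open Graph T public

YesInstance : ∀ {q n} → GMWCT q n → Set
YesInstance I =
  Σ (Subset size) λ E′ →
    ∣ E′ ∣ ≤ k ×
    (∀ i {u v} → u ∈ S i → v ∈ S i → u ≢ v →
       ¬ ∃ λ vs → IsPath (AdjacentWithout E′) u v vs)
  where open GMWCT I

-- The input as a sequence of numbers: n, the number of edges, k, the two
-- endpoints of every edge, and then the characteristic vectors of S₁, …, S_q.
encode : ∀ {q n} → GMWCT q n → List ℕ
encode {n = n} I =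
  n ∷ size ∷ k ∷
  concat (tabulate λ e → toℕ (proj₁ (ends e)) ∷ toℕ (proj₂ (ends e)) ∷ []) ++
  concat (tabulate λ i → List.map bit (toList (S i)))
  where
  open GMWCT I
  bit : Bool → ℕ
  bit b = if b then 1 else 0

------------------------------------------------------------------------
-- Unit-cost random access machine, programmed in a structured language

-- A state consists of registers and of an indirectly addressable memory.
-- A program mentions only finitely many registers.
record State : Set where
  constructor ⟨_,_⟩
  field
    reg : ℕ → ℕ
    mem : ℕ → ℕ

open State public

_[_↦_] : (ℕ → ℕ) → ℕ → ℕ → (ℕ → ℕ)
(f [ a ↦ x ]) b = if a ≡ᵇ b then x else f b

infixl 7 _⊕_ _⊖_
infix  6 _≔_ _≺_ _≈_
infixr 5 _⨾_

-- The only arithmetic is addition and truncated subtraction: with unit-cost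
-- multiplication, a machine on unbounded numbers would be unreasonably strong.
data Exp : Set where
  lit     : ℕ → Exp
  var     : ℕ → Exp
  load    : Exp → Exp
  _⊕_ _⊖_ : Exp → Exp → Exp

data Test : Set where
  _≺_ _≈_ : Exp → Exp → Test

data Program : Set where
  skip   : Program
  _≔_    : ℕ → Exp → Program
  store  : Exp → Exp → Program
  _⨾_    : Program → Program → Program
  branch : Test → Program → Program → Program
  while  : Test → Program → Program

eval : Exp → State → ℕ
eval (lit c)   σ = c
eval (var r)   σ = reg σ r
eval (load a)  σ = mem σ (eval a σ)
eval (e₁ ⊕ e₂) σ = eval e₁ σ + eval e₂ σ
eval (e₁ ⊖ e₂) σ = eval e₁ σ ∸ eval e₂ σ

test : Test → State → Bool
test (e₁ ≺ e₂) σ = eval e₁ σ <ᵇ eval e₂ σ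
test (e₁ ≈ e₂) σ = eval e₁ σ ≡ᵇ eval e₂ σ

-- Every constant, register access, memory access, arithmetic operation and
-- comparison takes one unit of time.
cost : Exp → ℕ
cost (lit c)   = 1
cost (var r)   = 1
cost (load a)  = suc (cost a)
cost (e₁ ⊕ e₂) = suc (cost e₁ + cost e₂)
cost (e₁ ⊖ e₂) = suc (cost e₁ + cost e₂)

testCost : Test → ℕ
testCost (e₁ ≺ e₂) = suc (cost e₁ + cost e₂)
testCost (e₁ ≈ e₂) = suc (cost e₁ + cost e₂)

-- Run P σ t σ′: started in state σ, P halts in state σ′ after time t.
data Run : Program → State → ℕ → State → Set where
  skip       : ∀ {σ} → Run skip σ 1 σ
  assign     : ∀ {r e σ} →
               Run (r ≔ e) σ (suc (cost e)) ⟨ reg σ [ r ↦ eval e σ ] , mem σ ⟩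
  store      : ∀ {a e σ} →
               Run (store a e) σ (suc (cost a + cost e))
                   ⟨ reg σ , mem σ [ eval a σ ↦ eval e σ ] ⟩
  seq        : ∀ {P Q σ₀ σ₁ σ₂ t₁ t₂} →
               Run P σ₀ t₁ σ₁ → Run Q σ₁ t₂ σ₂ →
               Run (P ⨾ Q) σ₀ (t₁ + t₂) σ₂
  if-true    : ∀ {b P Q σ σ′ t} → test b σ ≡ true → Run P σ t σ′ →
               Run (branch b P Q) σ (testCost b + t) σ′
  if-false   : ∀ {b P Q σ σ′ t} → test b σ ≡ false → Run Q σ t σ′ →
               Run (branch b P Q) σ (testCost b + t) σ′
  while-stop : ∀ {b P σ} → test b σ ≡ false →
               Run (while b P) σ (testCost b) σ
  while-step : ∀ {b P σ₀ σ₁ σ₂ t₁ t₂} → test b σ₀ ≡ true →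
               Run P σ₀ t₁ σ₁ → Run (while b P) σ₁ t₂ σ₂ →
               Run (while b P) σ₀ (testCost b + t₁ + t₂) σ₂

contents : List ℕ → ℕ → ℕ
contents []       a       = 0
contents (x ∷ xs) zero    = x
contents (x ∷ xs) (suc a) = contents xs a

-- The input occupies memory cells 0, 1, 2, …; all else is zero.
initial : List ℕ → State
initial input = ⟨ (λ _ → 0) , contents input ⟩

-- On the given input, P halts within the given time bound, leaving in
-- register 0 the truth value of A.
record Decides (P : Program) (input : List ℕ) (A : Set) (bound : ℕ) : Set where
  field
    time   : ℕ
    final  : State
    halts  : Run P (initial input) time final
    timely : time ≤ bound
    answer : (reg final 0 ≡ 1 × A) ⊎ (reg final 0 ≡ 0 × ¬ A)

{-# OPTIONS --safe #-}

-- Dynamic programming by leaf pruning.  For every vertex v keep a table of costs F v x, one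
-- for every set x of terminal classes: the least number of cuts in the part of the tree
-- already pruned towards v such that the component of v owns exactly the classes in x, each
-- once.  A leaf u is pruned into its neighbour p by either uniting disjoint labels of u and p,
-- or cutting their edge at cost 1.  The degree and the sum of the neighbours of every vertex
-- are enough to find the neighbour of a leaf, so no adjacency lists are needed: scan the
-- vertices in order, and whenever the current vertex is a leaf, prune it and go on with its
-- neighbour, otherwise go on with the scan.  Afterwards no leaf is left, hence by acyclicity
-- no edge, and the minima of the remaining tables add up to the optimum.  Costs are capped at
-- k + 1, which serves as infinity.

module Submission where

open import Data.Bool.Base using (Bool; true; false; if_then_else_)
import Data.Bool.Base as Bool
open import Data.Empty using (⊥)
open import Data.Fin.Base using (Fin; zero; suc; toℕ; fromℕ<; finToFun; funToFin)
open import Data.Fin.Properties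
  using (_≟_; toℕ-injective; suc-injective; finToFun-funToFin; any?; injective⇒≤; all?; toℕ≤pred[n]; toℕ<n; toℕ-fromℕ<)
open import Data.Fin.Subset using (Subset; ∣_∣) renaming (_∈_ to _∈ˢ_; _∉_ to _∉ˢ_)
open import Data.List.Base as List using (List; []; _∷_; _++_; length; concat; last)
open import Data.List.Membership.Propositional using (_∈_)
import Data.List.Membership.DecPropositional as DecMembership
open import Data.List.Properties using (length-++; length-map)
open import Data.List.Relation.Unary.All as All using (All; []; _∷_)
open import Data.List.Relation.Unary.AllPairs using ([]; _∷_)
open import Data.List.Relation.Unary.Any using (here; there)
open import Data.List.Relation.Unary.Linked using (Linked; []; [-]; _∷_)
open import Data.List.Relation.Unary.Unique.Propositional using (Unique)
open import Data.Maybe.Base using (just)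
open import Data.Nat.Base
open import Data.Nat.Properties hiding (suc-injective; _≟_)
open import Data.Nat.Properties using () renaming (_≟_ to _≟ℕ_)
open import Data.Product.Base using (Σ; ∃; ∃₂; _×_; _,_; proj₁; proj₂; map₁; map₂)
open import Data.Sum.Base using (_⊎_; inj₁; inj₂; swap)
open import Data.Unit.Base using (⊤)
open import Data.Vec.Base as Vec using ([]; _∷_; lookup; tabulate)
open import Data.Vec.Functional using (Vector; updateAt)
open import Data.Vec.Functional.Properties using (updateAt-updates; updateAt-minimal)
open import Data.Vec.Properties using (lookup⇒[]=; []=⇒lookup; lookup∘tabulate; length-toList)
open import Function.Base using (_∘_; const; _$_)
open import Level using (0ℓ)
open import Relation.Binary.Construct.Closure.ReflexiveTransitive as Star using (Star; ε; _◅_; _◅◅_)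
open import Relation.Binary.Core using (Rel)
open import Relation.Binary.PropositionalEquality
open import Relation.Nullary.Decidable using (Dec; yes; no; does; dec-true)
open import Relation.Nullary.Negation.Core using (¬_; contradiction)
open import Defs

open import Algebra.Properties.CommutativeMonoid.Sum +-0-commutativeMonoid
  using (sum; sum-cong-≗; sum-replicate-zero)

-- Finite sums

-- Correctness is stated through solvability instead of optimal values of subtrees: `Solution k A F`
-- is the problem left on the alive edges `A` with tables `F`, and one pruning preserves its
-- solvability in both directions. Leaves may therefore be pruned in any order, without a root.
-- Capping is harmless because every table entry used within a budget of `k` is at most `k`. The
-- delicate point is a linear bound for a scan that jumps to neighbours. A pruning changes degrees
-- only at the leaf and at its neighbour, so among the scanned vertices only the current one can be
-- a leaf and the scan never has to go back. Each round uses up an edge or a scan position, which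
-- gives at most `n + size` rounds. The inequality `size ≤ n` is read off the same loop: every
-- deleted edge is charged to a vertex that becomes isolated and stays so. Tables have `2 ^ q`
-- entries, a number known when the program is built. All work on them is unrolled into loop-free
-- code, whose time bound depends on `q` alone.

private
  variable
    n m : ℕ

sum-mono-≤ : {f g : Vector ℕ n} → (∀ i → f i ≤ g i) → sum f ≤ sum g
sum-mono-≤ {zero}  f≤g = z≤n
sum-mono-≤ {suc n} f≤g = +-mono-≤ (f≤g zero) (sum-mono-≤ (f≤g ∘ suc))

sum-mono-< : {f g : Vector ℕ n} → (∀ i → f i ≤ g i) → ∀ i → f i < g i → sum f < sum g
sum-mono-< f≤g zero    f<g = +-mono-<-≤ f<g (sum-mono-≤ (f≤g ∘ suc))
sum-mono-< f≤g (suc i) f<g = +-mono-≤-< (f≤g zero) (sum-mono-< (f≤g ∘ suc) i f<g)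

≤-sum : ∀ (f : Vector ℕ n) i → f i ≤ sum f
≤-sum f zero    = m≤m+n _ _
≤-sum f (suc i) = ≤-trans (≤-sum (f ∘ suc) i) (m≤n+m _ _)

sum-≤-size : (f : Vector ℕ n) → (∀ i → f i ≤ 1) → sum f ≤ n
sum-≤-size {zero}  f f≤1 = z≤n
sum-≤-size {suc n} f f≤1 = +-mono-≤ (f≤1 zero) (sum-≤-size (f ∘ suc) (f≤1 ∘ suc))

sum-zero : (f : Vector ℕ n) → (∀ i → f i ≡ 0) → sum f ≡ 0
sum-zero {n} f f≡0 = trans (sum-cong-≗ f≡0) (sum-replicate-zero n)

-- Written without subtraction: giving each sum the value that the other one has at `i` cancels the
-- only difference between them.
sum-exchange : {f g : Vector ℕ n} (i : Fin n) → (∀ j → j ≢ i → f j ≡ g j) →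
               sum f + g i ≡ sum g + f i
sum-exchange {f = f} {g} zero f≡g = begin
  f zero + sum (f ∘ suc) + g zero    ≡⟨ +-comm _ (g zero) ⟩
  g zero + (f zero + sum (f ∘ suc))  ≡⟨ cong (g zero +_) (+-comm (f zero) _) ⟩
  g zero + (sum (f ∘ suc) + f zero)  ≡⟨ +-assoc (g zero) _ _ ⟨
  g zero + sum (f ∘ suc) + f zero    ≡⟨ cong (λ s → g zero + s + f zero) (sum-cong-≗ λ j → f≡g (suc j) λ ()) ⟩
  g zero + sum (g ∘ suc) + f zero    ∎
  where open ≡-Reasoning
sum-exchange {f = f} {g} (suc i) f≡g = begin
  f zero + sum (f ∘ suc) + g (suc i)    ≡⟨ +-assoc (f zero) _ _ ⟩
  f zero + (sum (f ∘ suc) + g (suc i))  ≡⟨ cong₂ _+_ (f≡g zero λ ()) (sum-exchange i λ j j≢i → f≡g (suc j) (j≢i ∘ suc-injective)) ⟩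
  g zero + (sum (g ∘ suc) + f (suc i))  ≡⟨ +-assoc (g zero) _ _ ⟨
  g zero + sum (g ∘ suc) + f (suc i)    ∎
  where open ≡-Reasoning

sum-exchange₂ : {f g : Vector ℕ n} {u v : Fin n} → u ≢ v →
                (∀ j → j ≢ u → j ≢ v → f j ≡ g j) →
                sum f + (g u + g v) ≡ sum g + (f u + f v)
sum-exchange₂ {f = f} {g} {u} {v} u≢v f≡g = +-cancelʳ-≡ (sum h) _ _ $ begin
  sum f + (g u + g v) + sum h      ≡⟨ shuffle (sum f) (g u) (g v) (sum h) ⟩
  sum f + g u + (sum h + g v)      ≡⟨ cong₂ _+_ f→h h→g ⟩
  sum h + f u + (sum g + f v)      ≡⟨ +-comm (sum h + f u) _ ⟩
  sum g + f v + (sum h + f u)      ≡⟨ shuffle (sum g) (f v) (f u) (sum h) ⟨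
  sum g + (f v + f u) + sum h      ≡⟨ cong (λ s → sum g + s + sum h) (+-comm (f v) _) ⟩
  sum g + (f u + f v) + sum h      ∎
  where
  open ≡-Reasoning
  -- `h` lies halfway between `f` and `g`, so that two single exchanges suffice, joined by
  -- cancelling `sum h`.
  h = updateAt f u (const (g u))
  shuffle : ∀ a b c d → a + (b + c) + d ≡ a + b + (d + c)
  shuffle a b c d = trans (cong (_+ d) (sym (+-assoc a b c)))
                    (trans (+-assoc (a + b) c d) (cong (a + b +_) (+-comm c d)))
  f→h : sum f + g u ≡ sum h + f u
  f→h = trans (cong (sum f +_) (sym (updateAt-updates u f)))
              (sum-exchange u λ j j≢u → sym (updateAt-minimal j u f j≢u))
  h→g : sum h + g v ≡ sum g + f v
  h→g = trans (sum-exchange v agree) (cong (sum g +_) (updateAt-minimal v u f (u≢v ∘ sym)))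
    where
    agree : ∀ j → j ≢ v → h j ≡ g j
    agree j j≢v with j ≟ u
    ... | yes refl = updateAt-updates u f
    ... | no  j≢u  = trans (updateAt-minimal j u f j≢u) (f≡g j j≢u j≢v)

sum-isolate : (f : Vector ℕ n) (i : Fin n) → (∀ j → j ≢ i → f j ≡ 0) → sum f ≡ f i
sum-isolate {n} f i f≡0 = begin
  sum f                     ≡⟨ +-identityʳ _ ⟨
  sum f + 0                 ≡⟨ sum-exchange {g = const 0} i f≡0 ⟩
  sum {n} (const 0) + f i   ≡⟨ cong (_+ f i) (sum-replicate-zero n) ⟩
  f i                       ∎
  where open ≡-Reasoning

sum≡1⇒isolated : (f : Vector ℕ n) → sum f ≡ 1 → ∃ λ i → f i ≡ 1 × ∀ j → j ≢ i → f j ≡ 0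
sum≡1⇒isolated {suc n} f ∑f≡1 with f zero in eq
... | suc zero = zero , eq , λ where
        zero    j≢i → contradiction refl j≢i
        (suc j) _   → n≤0⇒n≡0 (≤-trans (≤-sum (f ∘ suc) j) (≤-reflexive (cong pred ∑f≡1)))
... | zero with i , fi≡1 , f≡0 ← sum≡1⇒isolated (f ∘ suc) ∑f≡1 =
        suc i , fi≡1 , λ where
          zero    _   → eq
          (suc j) j≢i → f≡0 j (j≢i ∘ cong suc)

-- Kronecker deltas and sums over subsets

δ : ℕ → ℕ → ℕ → ℕ
δ a b x = if a ≡ᵇ b then x else 0

≡ᵇ-refl : ∀ a → (a ≡ᵇ a) ≡ true
≡ᵇ-refl zero    = refl
≡ᵇ-refl (suc a) = ≡ᵇ-refl a

≢⇒≡ᵇ : ∀ {a b} → a ≢ b → (a ≡ᵇ b) ≡ false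
≢⇒≡ᵇ {a} {b} a≢b with a ≡ᵇ b in eq
... | false = refl
... | true  = contradiction (≡ᵇ⇒≡ a b (subst Bool.T (sym eq) _)) a≢b

<⇒<ᵇ≡true : ∀ {a b} → a < b → (a <ᵇ b) ≡ true
<⇒<ᵇ≡true {zero}  (s≤s _)       = refl
<⇒<ᵇ≡true {suc a} (s≤s a<b) = <⇒<ᵇ≡true a<b

≮⇒<ᵇ≡false : ∀ {a b} → ¬ a < b → (a <ᵇ b) ≡ false
≮⇒<ᵇ≡false {a} {b} a≮b with a <ᵇ b in eq
... | false = refl
... | true  = contradiction (<ᵇ⇒< a b (subst Bool.T (sym eq) _)) a≮b

<ᵇ-suc : ∀ {a b} → a ≢ b → (a <ᵇ suc b) ≡ (a <ᵇ b)
<ᵇ-suc {zero}  {zero}  a≢b = contradiction refl a≢b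
<ᵇ-suc {zero}  {suc b} a≢b = refl
<ᵇ-suc {suc a} {zero}  a≢b = refl
<ᵇ-suc {suc a} {suc b} a≢b = <ᵇ-suc (a≢b ∘ cong suc)

δ-same : ∀ a x → δ a a x ≡ x
δ-same a x = cong (if_then x else 0) (≡ᵇ-refl a)

δ-diff : ∀ {a b} x → a ≢ b → δ a b x ≡ 0
δ-diff x a≢b = cong (if_then x else 0) (≢⇒≡ᵇ a≢b)

mask : (Fin m → Bool) → Vector ℕ m → Vector ℕ m
mask A f e = if A e then f e else 0

count : (Fin m → Bool) → ℕ
count A = sum (mask A (const 1))

infixl 6 _─_
_─_ : (Fin m → Bool) → Fin m → Fin m → Bool
A ─ e = updateAt A e (const false)

─-same : ∀ (A : Fin m → Bool) e → (A ─ e) e ≡ false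
─-same A e = updateAt-updates e A

─-other : ∀ (A : Fin m → Bool) {e f} → f ≢ e → (A ─ e) f ≡ A f
─-other A {e} {f} = updateAt-minimal f e A

sum-mask-extend : ∀ {A A′ : Fin m → Bool} {e} (f : Vector ℕ m) → A e ≡ true → A′ e ≡ false →
                  (∀ j → j ≢ e → A j ≡ A′ j) → sum (mask A f) ≡ sum (mask A′ f) + f e
sum-mask-extend {A = A} {A′} {e} f Ae A′e agree = begin
  sum (mask A f)                   ≡⟨ +-identityʳ _ ⟨
  sum (mask A f) + 0               ≡⟨ cong (λ b → sum (mask A f) + (if b then f e else 0)) A′e ⟨
  sum (mask A f) + mask A′ f e     ≡⟨ sum-exchange e (λ j j≢e → cong (if_then f j else 0) (agree j j≢e)) ⟩
  sum (mask A′ f) + mask A f e     ≡⟨ cong (λ b → sum (mask A′ f) + (if b then f e else 0)) Ae ⟩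
  sum (mask A′ f) + f e            ∎
  where open ≡-Reasoning

sum-mask-─ : ∀ {A : Fin m → Bool} {e} (f : Vector ℕ m) → A e ≡ true →
             sum (mask A f) ≡ sum (mask (A ─ e) f) + f e
sum-mask-─ {A = A} {e} f Ae = sum-mask-extend f Ae (─-same A e) (λ j j≢e → sym (─-other A j≢e))

-- Paths, trees and leaves

private
  takeTo : ∀ {A : Set} {w : A} {vs} → w ∈ vs → List A
  takeTo {vs = x ∷ _} (here _)   = x ∷ []
  takeTo {vs = x ∷ _} (there w∈) = x ∷ takeTo w∈

  takeTo-all : ∀ {A : Set} {P : A → Set} {w} {vs} (w∈ : w ∈ vs) → All P vs → All P (takeTo w∈)
  takeTo-all (here _)   (p ∷ _)  = p ∷ []
  takeTo-all (there w∈) (p ∷ ps) = p ∷ takeTo-all w∈ ps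

  takeTo-unique : ∀ {A : Set} {w : A} {vs} (w∈ : w ∈ vs) → Unique vs → Unique (takeTo w∈)
  takeTo-unique (here _)   _        = [] ∷ []
  takeTo-unique (there w∈) (p ∷ ps) = takeTo-all w∈ p ∷ takeTo-unique w∈ ps

  takeTo-last : ∀ {A : Set} {w : A} {vs} (w∈ : w ∈ vs) → last (takeTo w∈) ≡ just w
  takeTo-last (here refl)        = refl
  takeTo-last (there (here refl)) = refl
  takeTo-last (there (there w∈)) = takeTo-last (there w∈)

module _ {n : ℕ} {R : Rel (Fin n) 0ℓ} where

  private
    suffix : ∀ {u v w} {vs} → w ∈ vs → IsPath R u v vs → ∃ (IsPath R w v)
    suffix (here refl) p = _ , record
      { linked = IsPath.linked p ; distinct = IsPath.distinct p ; starts = refl ; finishes = IsPath.finishes p }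
    suffix {vs = x ∷ y ∷ vs} (there w∈) p with _ ∷ l ← IsPath.linked p | _ ∷ d ← IsPath.distinct p =
      suffix w∈ record { linked = l ; distinct = d ; starts = refl ; finishes = IsPath.finishes p }

  -- Loop erasure: if `u` already lies on the path, the part from `u` on serves instead.
  -- Reachability can thus be handled by `Star`, which unlike paths is easily mapped, reversed and
  -- concatenated.
  extend-path : ∀ {u v w} → R u w → ∃ (IsPath R w v) → ∃ (IsPath R u v)
  extend-path {u} Ruw (x ∷ vs , p) with refl ← IsPath.starts p | DecMembership._∈?_ _≟_ u (x ∷ vs)
  ... | yes u∈ = suffix u∈ p
  ... | no  u∉ = u ∷ x ∷ vs , record
    { linked   = Ruw ∷ IsPath.linked p
    ; distinct = All.tabulate (λ { z∈ refl → u∉ z∈ }) ∷ IsPath.distinct p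
    ; starts   = refl
    ; finishes = IsPath.finishes p }

  star⇒path : ∀ {u v} → Star R u v → ∃ (IsPath R u v)
  star⇒path {u} ε    = u ∷ [] , record { linked = [-] ; distinct = [] ∷ [] ; starts = refl ; finishes = refl }
  star⇒path (r ◅ rs) = extend-path r (star⇒path rs)

  private
    linked⇒star : ∀ {u v vs} → Linked R (u ∷ vs) → last (u ∷ vs) ≡ just v → Star R u v
    linked⇒star [-]      refl = ε
    linked⇒star (r ∷ rs) eq   = r ◅ linked⇒star rs eq

  path⇒star : ∀ {u v} → ∃ (IsPath R u v) → Star R u v
  path⇒star (x ∷ vs , p) with refl ← IsPath.starts p = linked⇒star (IsPath.linked p) (IsPath.finishes p)

  private
    takeTo-linked : ∀ {w} {vs} (w∈ : w ∈ vs) → Linked R vs → Linked R (takeTo w∈)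
    takeTo-linked (here _)           _        = [-]
    takeTo-linked (there (here _))   (r ∷ _)  = r ∷ [-]
    takeTo-linked (there (there w∈)) (r ∷ rs) = r ∷ takeTo-linked (there w∈) rs

  -- The prefix ending at `w` also contains `x` and `y`, hence has three vertices; an edge from `w`
  -- back to `x` would close it to a cycle of the kind that `Acyclic` excludes.
  chord⇒cycle : ∀ {x y w vs} → Linked R (x ∷ y ∷ vs) → Unique (x ∷ y ∷ vs) → w ∈ vs →
                ∃ λ us → IsPath R x w us × 3 ≤ length us
  chord⇒cycle {x} l d w∈ = takeTo (there (there w∈)) , record
    { linked   = takeTo-linked (there (there w∈)) l
    ; distinct = takeTo-unique (there (there w∈)) d
    ; starts   = refl
    ; finishes = takeTo-last (there {x = x} (there w∈)) } , s≤s (s≤s (nonempty w∈))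
    where
    nonempty : ∀ {w} {vs} (w∈ : w ∈ vs) → 1 ≤ length (takeTo w∈)
    nonempty (here _)  = s≤s z≤n
    nonempty (there _) = s≤s z≤n

unique-length : {vs : List (Fin n)} → Unique vs → length vs ≤ n
unique-length {vs = vs} d = injective⇒≤ {f = List.lookup vs} (inj d)
  where
  all-lookup : ∀ {P : Fin n → Set} {us} → All P us → ∀ i → P (List.lookup us i)
  all-lookup (p ∷ _)  zero    = p
  all-lookup (_ ∷ ps) (suc i) = all-lookup ps i
  inj : ∀ {us : List (Fin n)} → Unique us → ∀ {i j} → List.lookup us i ≡ List.lookup us j → i ≡ j
  inj (_ ∷ _) {zero}  {zero}  _  = refl
  inj (p ∷ _) {zero}  {suc j} eq = contradiction eq (all-lookup p j)
  inj (p ∷ _) {suc i} {zero}  eq = contradiction (sym eq) (all-lookup p i)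
  inj (_ ∷ d) {suc i} {suc j} eq = cong suc (inj d eq)

-- Degrees, neighbour sums and leaves

module GraphProperties {n : ℕ} (G : Graph n) where
  open Graph G

  incidence : Fin size → Fin n → ℕ
  incidence e w = δ (toℕ (proj₁ (ends e))) (toℕ w) 1 + δ (toℕ (proj₂ (ends e))) (toℕ w) 1

  -- The number of the other end if `w` is an end of `e`, and 0 otherwise. As 0 is also the number
  -- of a vertex, sums of these values are informative only together with the degree.
  opposite : Fin size → Fin n → ℕ
  opposite e w = δ (toℕ (proj₁ (ends e))) (toℕ w) (toℕ (proj₂ (ends e)))
               + δ (toℕ (proj₂ (ends e))) (toℕ w) (toℕ (proj₁ (ends e)))

  degree : (Fin size → Bool) → Fin n → ℕ
  degree A w = sum (mask A λ e → incidence e w)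

  neighbourSum : (Fin size → Bool) → Fin n → ℕ
  neighbourSum A w = sum (mask A λ e → opposite e w)

  joins-incidence : ∀ {e u p} → Joins e u p → ∀ w →
                    incidence e w ≡ δ (toℕ u) (toℕ w) 1 + δ (toℕ p) (toℕ w) 1
  joins-incidence (inj₁ eq) w rewrite eq = refl
  joins-incidence {u = u} {p} (inj₂ eq) w rewrite eq = +-comm (δ (toℕ p) (toℕ w) 1) _

  joins-opposite : ∀ {e u p} → Joins e u p → ∀ w →
                   opposite e w ≡ δ (toℕ u) (toℕ w) (toℕ p) + δ (toℕ p) (toℕ w) (toℕ u)
  joins-opposite (inj₁ eq) w rewrite eq = refl
  joins-opposite {u = u} {p} (inj₂ eq) w rewrite eq = +-comm (δ (toℕ p) (toℕ w) (toℕ u)) _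

  joins-distinct : ∀ {e u p} → Joins e u p → u ≢ p
  joins-distinct j refl = loopless j

  joins-sym : ∀ {e u p} → Joins e u p → Joins e p u
  joins-sym = swap

  private
    toℕ-≢ : ∀ {u v : Fin n} → u ≢ v → toℕ u ≢ toℕ v
    toℕ-≢ u≢v = u≢v ∘ toℕ-injective

  joins⇒incidence≡1 : ∀ {e u p} → Joins e u p → incidence e u ≡ 1
  joins⇒incidence≡1 {e} {u} {p} j =
    trans (joins-incidence j u)
          (cong₂ _+_ (δ-same (toℕ u) 1) (δ-diff 1 (toℕ-≢ (joins-distinct j ∘ sym))))

  joins⇒opposite : ∀ {e u p} → Joins e u p → opposite e u ≡ toℕ p
  joins⇒opposite {e} {u} {p} j =
    trans (joins-opposite j u)
          (trans (cong₂ _+_ (δ-same (toℕ u) _) (δ-diff _ (toℕ-≢ (joins-distinct j ∘ sym)))) (+-identityʳ _))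

  Incident : Fin size → Fin n → Set
  Incident e u = ∃ (Joins e u)

  incident? : ∀ e u → Dec (Incident e u)
  incident? e u with proj₁ (ends e) ≟ u
  ... | yes refl = yes (_ , inj₁ refl)
  ... | no  a≢u with proj₂ (ends e) ≟ u
  ...   | yes refl = yes (_ , inj₂ refl)
  ...   | no  b≢u  = no λ { (_ , inj₁ eq) → a≢u (cong proj₁ eq) ; (_ , inj₂ eq) → b≢u (cong proj₂ eq) }

  ¬incident⇒0 : ∀ {e u} → ¬ Incident e u → incidence e u ≡ 0 × opposite e u ≡ 0
  ¬incident⇒0 {e} {u} ¬i =
    cong₂ _+_ (δ-diff 1 a≢u) (δ-diff 1 b≢u) , cong₂ _+_ (δ-diff _ a≢u) (δ-diff _ b≢u)
    where
    a≢u : toℕ (proj₁ (ends e)) ≢ toℕ u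
    a≢u eq = ¬i (_ , inj₁ (cong (λ a → a , proj₂ (ends e)) (toℕ-injective eq)))
    b≢u : toℕ (proj₂ (ends e)) ≢ toℕ u
    b≢u eq = ¬i (_ , inj₂ (cong (λ b → proj₁ (ends e) , b) (toℕ-injective eq)))

  incident⇒1 : ∀ {e u} → Incident e u → incidence e u ≡ 1
  incident⇒1 (_ , j) = joins⇒incidence≡1 j

  record Leaf (A : Fin size → Bool) (u : Fin n) : Set where
    field
      edge     : Fin size
      parent   : Fin n
      alive    : A edge ≡ true
      joins    : Joins edge u parent
      only     : ∀ {f} → A f ≡ true → f ≢ edge → ¬ Incident f u
      pointer  : neighbourSum A u ≡ toℕ parent

  -- A single alive edge contributes to the degree, so the same edge gives the only term of the
  -- neighbour sum that can be nonzero, and this term is the number of the other end.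
  leaf : ∀ {A u} → degree A u ≡ 1 → Leaf A u
  leaf {A} {u} deg≡1 with e , at-e , off-e ← sum≡1⇒isolated _ deg≡1 with A e in Ae
  ... | true with incident? e u
  ...   | no ¬i = contradiction (trans (sym at-e) (proj₁ (¬incident⇒0 ¬i))) λ ()
  ...   | yes (p , j) = record
    { edge    = e
    ; parent  = p
    ; alive   = Ae
    ; joins   = j
    ; only    = only
    ; pointer = trans (sum-isolate _ e others)
                      (trans (cong (if_then opposite e u else 0) Ae) (joins⇒opposite j)) }
    where
    only : ∀ {f} → A f ≡ true → f ≢ e → ¬ Incident f u
    only {f} Af f≢e i = contradiction
      (trans (sym (off-e f f≢e)) (trans (cong (if_then incidence f u else 0) Af) (incident⇒1 i))) λ ()
    others : ∀ f → f ≢ e → mask A (λ f → opposite f u) f ≡ 0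
    others f f≢e with A f in Af
    ... | false = refl
    ... | true  = proj₂ (¬incident⇒0 (only Af f≢e))

  module _ (acyclic : Acyclic Adjacent) where

    private
      -- The path may use any edges of the graph, as acyclicity applies to all of them. Only the
      -- edge at its front has to be alive, because the path grows there.
      record Trail (A : Fin size → Bool) (ℓ : ℕ) : Set where
        field
          {x y}    : Fin n
          {vs}     : List (Fin n)
          linked   : Linked Adjacent (x ∷ y ∷ vs)
          distinct : Unique (x ∷ y ∷ vs)
          len      : ℓ ≤ length vs
          edge     : Fin size
          alive    : A edge ≡ true
          joins    : Joins edge x y

      -- The front vertex `x` has an alive edge and a degree other than 1, hence a second alive
      -- edge. Its far end is new: equal to `x` it would give a loop, equal to `y` a parallel edge,
      -- equal to a later vertex a cycle.
      grow : ∀ {A ℓ} → (∀ w → degree A w ≢ 1) → Trail A ℓ → Trail A (suc ℓ)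
      grow {A} {ℓ} deg≢1 t = step (any? λ f → other? f)
        where
        open Trail t
        Other : Fin size → Set
        Other f = A f ≡ true × f ≢ edge × Incident f x
        other? : ∀ f → Dec (Other f)
        other? f with A f | f ≟ edge | incident? f x
        ... | false | _      | _     = no λ ()
        ... | true  | yes eq | _     = no λ o → proj₁ (proj₂ o) eq
        ... | true  | no _   | no ¬i = no λ o → ¬i (proj₂ (proj₂ o))
        ... | true  | no f≢  | yes i = yes (refl , f≢ , i)
        step : Dec (∃ Other) → Trail A (suc ℓ)
        step (no ¬other) = contradiction
          (trans (sum-isolate _ edge others)
                 (trans (cong (if_then incidence edge x else 0) alive) (joins⇒incidence≡1 joins)))
          (deg≢1 x)
          where
          others : ∀ f → f ≢ edge → mask A (λ f → incidence f x) f ≡ 0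
          others f f≢ with A f in Af
          ... | false = refl
          ... | true  = proj₁ (¬incident⇒0 λ i → ¬other (f , Af , f≢ , i))
        step (yes (f , Af , f≢ , w , j)) = record
          { linked   = (f , joins-sym j) ∷ linked
          ; distinct = All.tabulate fresh ∷ distinct
          ; len      = s≤s len
          ; edge     = f
          ; alive    = Af
          ; joins    = joins-sym j }
          where
          fresh : ∀ {z} → z ∈ (x ∷ y ∷ vs) → w ≢ z
          fresh (here refl)         refl = loopless j
          fresh (there (here refl)) refl = f≢ (no-parallel j joins)
          fresh (there (there w∈))  refl
            with _ , path , long ← chord⇒cycle linked distinct w∈ = acyclic path long (f , joins-sym j)

    -- An alive edge would start a trail that can be grown `n` times, to a path with more vertices
    -- than there are.
    leafless⇒edgeless : ∀ {A} → (∀ w → degree A w ≢ 1) → ∀ e → A e ≡ false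
    leafless⇒edgeless {A} deg≢1 e with A e in Ae
    ... | false = refl
    ... | true  = contradiction (unique-length (Trail.distinct (iterate n)))
                    (<⇒≱ (s≤s (≤-trans (Trail.len (iterate n)) (n≤1+n _))))
      where
      start : Trail A 0
      start = record
        { linked   = (e , inj₁ refl) ∷ [-]
        ; distinct = ((λ eq → loopless (inj₁ (cong (λ b → proj₁ (ends e) , b) (sym eq)))) ∷ []) ∷ [] ∷ []
        ; len      = z≤n
        ; edge     = e
        ; alive    = Ae
        ; joins    = inj₁ refl }
      iterate : ∀ ℓ → Trail A ℓ
      iterate zero    = start
      iterate (suc ℓ) = grow deg≢1 (iterate ℓ)

-- Labels and pruning

-- A label stands for a set of terminal classes, given by its binary digits.
module Labels (q : ℕ) where

  Label : Set
  Label = Fin (2 ^ q)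

  bit : Label → Fin q → ℕ
  bit x i = toℕ (finToFun {2} {q} x i)

  bit≤1 : ∀ x i → bit x i ≤ 1
  bit≤1 x i = toℕ≤pred[n] (finToFun {2} {q} x i)

  -- Every nonzero value is rounded to the digit 1, whence the bound assumed in `bit-code`.
  code : (Fin q → ℕ) → Label
  code f = funToFin λ i → if f i ≡ᵇ 0 then zero else suc zero

  bit-code : ∀ f i → f i ≤ 1 → bit (code f) i ≡ f i
  bit-code f i f≤1 = trans (cong toℕ (finToFun-funToFin {q} {2} _ i)) (digit f≤1)
    where
    digit : ∀ {b} → b ≤ 1 → toℕ {2} (if b ≡ᵇ 0 then zero else suc zero) ≡ b
    digit z≤n       = refl
    digit (s≤s z≤n) = refl

  Disjoint : Rel Label 0ℓ
  Disjoint a b = ∀ i → bit a i + bit b i ≤ 1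

  -- Union of disjoint sets as addition of digits without carry: the digits of `c` are at most 1,
  -- which forces disjointness.
  Merge : Label → Label → Label → Set
  Merge a b c = ∀ i → bit a i + bit b i ≡ bit c i

  opaque
    merge? : ∀ a b c → Dec (Merge a b c)
    merge? a b c = all? λ i → bit a i + bit b i ≟ℕ bit c i

  disjoint-sym : ∀ {a b} → Disjoint a b → Disjoint b a
  disjoint-sym {a} {b} d i = ≤-trans (≤-reflexive (+-comm (bit b i) (bit a i))) (d i)

  disjoint⇒merge : ∀ {a b} → Disjoint a b → ∃ (Merge a b)
  disjoint⇒merge {a} {b} d = code a+b , λ i → sym (bit-code a+b i (d i))
    where
    a+b : Fin q → ℕ
    a+b i = bit a i + bit b i

  merge⇒disjoint : ∀ {a b c} → Merge a b c → Disjoint a b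
  merge⇒disjoint {c = c} μ i = ≤-trans (≤-reflexive (μ i)) (bit≤1 c i)

  merge-disjointˡ : ∀ {a b c d} → Merge a b c → Disjoint c d → Disjoint a d
  merge-disjointˡ {d = d} μ δ i =
    ≤-trans (+-monoˡ-≤ (bit d i) (≤-trans (m≤m+n _ _) (≤-reflexive (μ i)))) (δ i)

  merge-disjointʳ : ∀ {a b c d} → Merge a b c → Disjoint c d → Disjoint b d
  merge-disjointʳ {d = d} μ δ i =
    ≤-trans (+-monoˡ-≤ (bit d i) (≤-trans (m≤n+m _ _) (≤-reflexive (μ i)))) (δ i)

  -- A digit 1 of `c` comes from exactly one of `a` and `b`, and the hypothesis about that one
  -- applies.
  merge-disjoint : ∀ {a b c d} → Merge a b c → Disjoint a d → Disjoint b d → Disjoint c d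
  merge-disjoint {a} {b} {c} {d} μ ad bd i = digits (bit a i) (bit b i) (μ i) (bit≤1 c i) (ad i) (bd i)
    where
    digits : ∀ x y {z w} → x + y ≡ z → z ≤ 1 → x + w ≤ 1 → y + w ≤ 1 → z + w ≤ 1
    digits zero    y       refl _         _   y+w = y+w
    digits (suc x) zero    refl _         x+w _   = subst (λ x → suc (x + _) ≤ 1) (sym (+-identityʳ x)) x+w
    digits (suc x) (suc y) refl (s≤s x+y) _   _   = contradiction (≤-trans (m≤n+m (suc y) x) x+y) λ ()

  -- The update of the costs f of a vertex by the costs g of an adjacent leaf: either the leaf
  -- stays connected and the two labels are united, or it is cut off and its label is forgotten.
  record Relaxed (k : ℕ) (f g h : Label → ℕ) : Set where
    field
      below-merge : ∀ {a b c} → Merge a b c → h c ≤ f a + g b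
      below-cut   : ∀ b c → h c ≤ f c + suc (g b)
      attained    : ∀ c → h c ≤ k →
                    (∃₂ λ a b → Merge a b c × h c ≡ f a + g b) ⊎ (∃ λ b → h c ≡ f c + suc (g b))

  -- Pruning a leaf preserves solvability

  module Solutions {n : ℕ} (G : Graph n) where
    open Graph G
    open GraphProperties G

    Kept : (A C : Fin size → Bool) → Rel (Fin n) 0ℓ
    Kept A C u v = ∃ λ e → A e ≡ true × C e ≡ false × Joins e u v

    total : (Fin n → Label → ℕ) → (Fin n → Label) → ℕ
    total F X = sum λ v → F v (X v)

    -- The problem that remains when only the edges in A are left: v may choose any label x,
    -- at the price F v x.
    record Solution (k : ℕ) (A : Fin size → Bool) (F : Fin n → Label → ℕ) : Set where
      field
        cut      : Fin size → Bool
        label    : Fin n → Label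
        cheap    : count cut + total F label ≤ k
        disjoint : ∀ {u v} → u ≢ v → Star (Kept A cut) u v → Disjoint (label u) (label v)

    kept-sym : ∀ {A C u v} → Kept A C u v → Kept A C v u
    kept-sym (e , Ae , Ce , j) = e , Ae , Ce , joins-sym j

    stranded : ∀ {R : Rel (Fin n) 0ℓ} {u w} → (∀ {v} → ¬ R u v) → Star R u w → u ≡ w
    stranded ¬R ε       = refl
    stranded ¬R (r ◅ _) = contradiction r ¬R

    private
      -- In the uses `s` and `s′` are the total costs before and after a pruning, `b` and `a` the
      -- old and new entries at the two vertices concerned, and `c` is 1 or 0 according to whether
      -- the edge was cut.
      cancel-≤ : ∀ {s s′} a {b} c → s + a ≡ s′ + b → a ≤ b + c → s′ ≤ s + c
      cancel-≤ {s} {s′} a {b} c eq a≤ = +-cancelʳ-≤ b s′ (s + c) $ begin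
        s′ + b       ≡⟨ eq ⟨
        s + a        ≤⟨ +-monoʳ-≤ s a≤ ⟩
        s + (b + c)  ≡⟨ cong (s +_) (+-comm b c) ⟩
        s + (c + b)  ≡⟨ +-assoc s c b ⟨
        s + c + b    ∎
        where open ≤-Reasoning

    module _ {k : ℕ} {A : Fin size → Bool} {u : Fin n} {F F′ : Fin n → Label → ℕ} (ℓ : Leaf A u) where
      open Leaf ℓ renaming (edge to e; parent to p)

      private
        A′ : Fin size → Bool
        A′ = A ─ e

        u≢p : u ≢ p
        u≢p = joins-distinct joins

        A′⇒A : ∀ {f} → A′ f ≡ true → A f ≡ true
        A′⇒A {f} A′f with f ≟ e
        ... | yes refl = contradiction (trans (sym A′f) (─-same A e)) λ ()
        ... | no  f≢e  = trans (sym (─-other A f≢e)) A′f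

        A′⇒≢ : ∀ {f} → A′ f ≡ true → f ≢ e
        A′⇒≢ A′f refl = contradiction (trans (sym A′f) (─-same A e)) λ ()

        A⇒A′ : ∀ {f} → f ≢ e → A f ≡ true → A′ f ≡ true
        A⇒A′ f≢e Af = trans (─-other A f≢e) Af

        isolated : ∀ {C v} → ¬ Kept A′ C u v
        isolated (f , A′f , _ , j) = only (A′⇒A A′f) (A′⇒≢ A′f) (_ , j)

        shrink : ∀ {C v w} → Kept A′ C v w → Kept A C v w
        shrink (f , A′f , Cf , j) = f , A′⇒A A′f , Cf , j

      module _ (vanish : ∀ x → F′ u x ≡ 0) (relaxed : Relaxed k (F p) (F u) (F′ p))
               (other : ∀ w → w ≢ u → w ≢ p → ∀ x → F′ w x ≡ F w x) where
        open Relaxed relaxed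

        private
          -- The tables differ only at `u` and `p`, and the new entry of `u` is 0 under any label,
          -- so it drops out of the equation.
          exchange : ∀ {X X′} → (∀ v → v ≢ u → v ≢ p → X v ≡ X′ v) →
                     total F X + F′ p (X′ p) ≡ total F′ X′ + (F u (X u) + F p (X p))
          exchange {X} {X′} agree = trans
            (cong (λ s → total F X + (s + F′ p (X′ p))) (sym (vanish (X′ u))))
            (sum-exchange₂ u≢p λ v v≢u v≢p → trans (sym (other v v≢u v≢p (X v))) (cong (F′ v) (agree v v≢u v≢p)))

        -- If `e` is cut, it leaves the cut and its unit cost moves into the table of `p`. If it is
        -- kept, `u` and `p` are connected, so their labels are disjoint and `p` takes over the
        -- union. The label of `u` no longer matters, since `u` is now isolated and free.
        prune⇒ : Solution k A F → Solution k A′ F′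
        prune⇒ S = by-cases (cut e) refl
          where
          open Solution S
          by-cases : ∀ b → cut e ≡ b → Solution k A′ F′
          by-cases true Ce = record
            { cut      = cut ─ e
            ; label    = label
            ; cheap    = ≤-trans (≤-trans (+-monoʳ-≤ (count (cut ─ e)) total≤) (≤-reflexive count≡)) cheap
            ; disjoint = λ v≢w s → disjoint v≢w (Star.gmap (λ v → v) widen s) }
            where
            widen : ∀ {v w} → Kept A′ (cut ─ e) v w → Kept A cut v w
            widen (f , A′f , Cf , j) = f , A′⇒A A′f , trans (sym (─-other cut (A′⇒≢ A′f))) Cf , j
            total≤ : total F′ label ≤ total F label + 1
            total≤ = cancel-≤ (F′ p (label p)) 1 (exchange λ _ _ _ → refl) (≤-trans (below-cut (label u) (label p))
              (≤-reflexive (trans (+-suc _ _) (trans (cong suc (+-comm (F p (label p)) _)) (+-comm 1 _)))))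
            count≡ : count (cut ─ e) + (total F label + 1) ≡ count cut + total F label
            count≡ = trans (cong (count (cut ─ e) +_) (+-comm (total F label) 1))
                    (trans (sym (+-assoc (count (cut ─ e)) 1 _))
                           (cong (_+ total F label) (sym (sum-mask-─ {A = cut} {e} (const 1) Ce))))
          by-cases false Ce
            with c , merge ← disjoint⇒merge {label p} {label u}
                               (disjoint (u≢p ∘ sym) ((e , alive , Ce , joins-sym joins) ◅ ε)) = record
            { cut      = cut
            ; label    = X′
            ; cheap    = ≤-trans (+-monoʳ-≤ (count cut) total≤) cheap
            ; disjoint = disjoint′ }
            where
            X′ = updateAt label p (const c)
            X′p : X′ p ≡ c
            X′p = updateAt-updates p label
            total≤ : total F′ X′ ≤ total F label
            total≤ = ≤-trans (cancel-≤ (F′ p (X′ p)) 0 (exchange λ v _ v≢p → sym (updateAt-minimal v p label v≢p))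
              (≤-trans (subst (λ x → F′ p x ≤ _) (sym X′p) (below-merge merge))
                       (≤-reflexive (trans (+-comm (F p (label p)) _) (sym (+-identityʳ _))))))
              (≤-reflexive (+-identityʳ _))
            from-p : ∀ {w} → w ≢ u → w ≢ p → Star (Kept A′ cut) p w → Disjoint (X′ p) (X′ w)
            from-p {w} w≢u w≢p s rewrite X′p | updateAt-minimal w p {const c} label w≢p =
              merge-disjoint {label p} {label u} {c} {label w} merge
                (disjoint (w≢p ∘ sym) s′)
                (disjoint (w≢u ∘ sym) ((e , alive , Ce , joins) ◅ s′))
              where s′ = Star.gmap (λ v → v) shrink s
            disjoint′ : ∀ {v w} → v ≢ w → Star (Kept A′ cut) v w → Disjoint (X′ v) (X′ w)
            disjoint′ {v} {w} v≢w s with v ≟ u | w ≟ u | v ≟ p | w ≟ p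
            ... | yes refl | _        | _        | _        = contradiction (stranded isolated s) v≢w
            ... | no _     | yes refl | _        | _        =
                  contradiction (sym (stranded isolated (Star.reverse kept-sym s))) v≢w
            ... | no _     | no _     | yes refl | yes refl = contradiction refl v≢w
            ... | no _     | no w≢u   | yes refl | no w≢p   = from-p w≢u w≢p s
            ... | no v≢u   | no _     | no v≢p   | yes refl =
                  disjoint-sym {X′ p} {X′ v} (from-p v≢u v≢p (Star.reverse kept-sym s))
            ... | no _     | no _     | no v≢p   | no w≢p
                  rewrite updateAt-minimal v p {const c} label v≢p | updateAt-minimal w p {const c} label w≢p =
                  disjoint v≢w (Star.gmap (λ v → v) shrink s)

        -- The entry of `p` is part of a total of at most `k`, so it is below the cap and `attained`
        -- tells which of the two options produced it. That option is undone.
        prune⇐ : Solution k A′ F′ → Solution k A F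
        prune⇐ S with attained (Solution.label S p)
                               (≤-trans (≤-sum (λ v → F′ v (Solution.label S v)) p)
                                        (≤-trans (m≤n+m _ _) (Solution.cheap S)))
        ... | inj₁ (a , b , merge , eq) = record
          { cut      = cut ─ e
          ; label    = X
          ; cheap    = ≤-trans (+-mono-≤ (sum-mono-≤ fewer) (≤-reflexive total≡)) cheap
          ; disjoint = disjoint′ }
          where
          open Solution S
          c = label p
          X = updateAt (updateAt label p (const a)) u (const b)
          Xu : X u ≡ b
          Xu = updateAt-updates u (updateAt label p (const a))
          Xp : X p ≡ a
          Xp = trans (updateAt-minimal p u _ (u≢p ∘ sym)) (updateAt-updates p label)
          Xo : ∀ v → v ≢ u → v ≢ p → X v ≡ label v
          Xo v v≢u v≢p = trans (updateAt-minimal v u _ v≢u) (updateAt-minimal v p label v≢p)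
          total≡ : total F X ≡ total F′ label
          total≡ = +-cancelʳ-≡ (F′ p c) _ _ (trans (exchange Xo) (cong (total F′ label +_)
            (trans (cong₂ (λ x y → F u x + F p y) Xu Xp) (trans (+-comm (F u b) _) (sym eq)))))
          -- The given cut may contain `e`, which is dead there. Removing it ensures that `e` joins
          -- `u` to `p` again, and costs nothing.
          fewer : ∀ f → mask (cut ─ e) (const 1) f ≤ mask cut (const 1) f
          fewer f with f ≟ e
          ... | yes refl = ≤-trans (≤-reflexive (cong (if_then 1 else 0) (─-same cut e))) z≤n
          ... | no  f≢e  = ≤-reflexive (cong (if_then 1 else 0) (─-other cut f≢e))
          -- Contracting e sends u to p.
          π : Fin n → Fin n
          π v with v ≟ u
          ... | yes _ = p
          ... | no  _ = v
          πu : π u ≡ p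
          πu with u ≟ u
          ... | yes _  = refl
          ... | no u≢u = contradiction refl u≢u
          πo : ∀ {v} → v ≢ u → π v ≡ v
          πo {v} v≢u with v ≟ u
          ... | yes v≡u = contradiction v≡u v≢u
          ... | no _    = refl
          contract-edge : ∀ {v w} → Joins e v w → π v ≡ π w
          contract-edge {v} {w} j with joins | j
          ... | inj₁ h | inj₁ h′ with refl ← trans (sym h) h′ = trans πu (sym (πo (u≢p ∘ sym)))
          ... | inj₁ h | inj₂ h′ with refl ← trans (sym h) h′ = trans (πo (u≢p ∘ sym)) (sym πu)
          ... | inj₂ h | inj₁ h′ with refl ← trans (sym h) h′ = trans (πo (u≢p ∘ sym)) (sym πu)
          ... | inj₂ h | inj₂ h′ with refl ← trans (sym h) h′ = trans πu (sym (πo (u≢p ∘ sym)))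
          -- The edge `e` collapses to a point; any other alive edge avoids `u`, so `π` fixes both
          -- of its ends.
          contract-step : ∀ {v w} → Kept A (cut ─ e) v w → Star (Kept A′ cut) (π v) (π w)
          contract-step {v} {w} (f , Af , Cf , j) with f ≟ e
          ... | yes refl = subst (Star (Kept A′ cut) (π v)) (contract-edge j) ε
          ... | no f≢e   = subst₂ (Star (Kept A′ cut))
                (sym (πo λ { refl → only Af f≢e (_ , j) })) (sym (πo λ { refl → only Af f≢e (_ , joins-sym j) }))
                ((f , A⇒A′ f≢e Af , trans (sym (─-other cut f≢e)) Cf , j) ◅ ε)
          contract : ∀ {v w} → Star (Kept A (cut ─ e)) v w → Star (Kept A′ cut) (π v) (π w)
          contract ε       = ε
          contract (r ◅ s) = contract-step r ◅◅ contract s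
          from-u : ∀ {w} → w ≢ u → Star (Kept A (cut ─ e)) u w → Disjoint (X u) (X w)
          from-u {w} w≢u s with w ≟ p
          ... | yes refl rewrite Xu | Xp = disjoint-sym {a} {b} (merge⇒disjoint {a} {b} {c} merge)
          ... | no  w≢p  rewrite Xu | Xo w w≢u w≢p = merge-disjointʳ {a} {b} {c} {label w} merge
                (disjoint (w≢p ∘ sym) (subst₂ (Star (Kept A′ cut)) πu (πo w≢u) (contract s)))
          from-p : ∀ {w} → w ≢ u → w ≢ p → Star (Kept A (cut ─ e)) p w → Disjoint (X p) (X w)
          from-p {w} w≢u w≢p s rewrite Xp | Xo w w≢u w≢p = merge-disjointˡ {a} {b} {c} {label w} merge
                (disjoint (w≢p ∘ sym) (subst₂ (Star (Kept A′ cut)) (πo (u≢p ∘ sym)) (πo w≢u) (contract s)))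
          disjoint′ : ∀ {v w} → v ≢ w → Star (Kept A (cut ─ e)) v w → Disjoint (X v) (X w)
          disjoint′ {v} {w} v≢w s with v ≟ u | w ≟ u | v ≟ p | w ≟ p
          ... | yes refl | yes refl | _        | _        = contradiction refl v≢w
          ... | yes refl | no w≢u   | _        | _        = from-u w≢u s
          ... | no v≢u   | yes refl | _        | _        =
                disjoint-sym {X u} {X v} (from-u v≢u (Star.reverse kept-sym s))
          ... | no _     | no _     | yes refl | yes refl = contradiction refl v≢w
          ... | no _     | no w≢u   | yes refl | no w≢p   = from-p w≢u w≢p s
          ... | no v≢u   | no _     | no v≢p   | yes refl =
                disjoint-sym {X p} {X v} (from-p v≢u v≢p (Star.reverse kept-sym s))
          ... | no v≢u   | no w≢u   | no v≢p   | no w≢p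
                rewrite Xo v v≢u v≢p | Xo w w≢u w≢p =
                disjoint v≢w (subst₂ (Star (Kept A′ cut)) (πo v≢u) (πo w≢u) (contract s))
        ... | inj₂ (b , eq) = record
          { cut      = C
          ; label    = X
          ; cheap    = ≤-trans (≤-trans (+-monoˡ-≤ _ count≤)
              (≤-reflexive (trans (+-assoc (count cut) 1 _) (cong (count cut +_) total≡)))) cheap
          ; disjoint = disjoint′ }
          where
          open Solution S
          C = updateAt cut e (const true)
          Ce : C e ≡ true
          Ce = updateAt-updates e cut
          Co : ∀ {f} → f ≢ e → C f ≡ cut f
          Co f≢e = updateAt-minimal _ e cut f≢e
          X = updateAt label u (const b)
          Xu : X u ≡ b
          Xu = updateAt-updates u label
          Xo : ∀ v → v ≢ u → X v ≡ label v
          Xo v v≢u = updateAt-minimal v u label v≢u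
          total≡ : suc (total F X) ≡ total F′ label
          total≡ = +-cancelʳ-≡ (F u (X u) + F p (X p)) _ _
                   (trans (trans (sym (+-suc (total F X) _)) (cong (total F X +_)
                     (trans (cong suc (+-comm (F u (X u)) _)) (trans (sym (+-suc _ _))
                       (trans (cong₂ (λ x y → F p x + suc (F u y)) (Xo p (u≢p ∘ sym)) Xu) (sym eq))))))
                   (exchange λ v v≢u _ → Xo v v≢u))
          -- Only an inequality, since the given cut may already contain the dead edge `e`.
          count≤ : count C ≤ count cut + 1
          count≤ = ≤-trans (m≤m+n _ _) (≤-trans (≤-reflexive (sum-exchange e λ f f≢e → cong (if_then 1 else 0) (Co f≢e)))
                     (+-monoʳ-≤ (count cut) (≤-reflexive (cong (if_then 1 else 0) Ce))))
          narrow : ∀ {v w} → Kept A C v w → Kept A′ cut v w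
          narrow (f , Af , Cf , j) with f ≟ e
          ... | yes refl = contradiction (trans (sym Cf) Ce) λ ()
          ... | no f≢e   = f , A⇒A′ f≢e Af , trans (sym (Co f≢e)) Cf , j
          disjoint′ : ∀ {v w} → v ≢ w → Star (Kept A C) v w → Disjoint (X v) (X w)
          disjoint′ {v} {w} v≢w s with v ≟ u | w ≟ u
          ... | yes refl | _        = contradiction (stranded (isolated ∘ narrow) s) v≢w
          ... | no _     | yes refl = contradiction (sym (stranded (isolated ∘ narrow) (Star.reverse kept-sym s))) v≢w
          ... | no v≢u   | no w≢u rewrite Xo v v≢u | Xo w w≢u = disjoint v≢w (Star.gmap (λ v → v) narrow s)

-- The multiway cut problem as a labelling problem

∣_∣≡count : ∀ {m} (p : Subset m) → ∣ p ∣ ≡ count (lookup p)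
∣ []        ∣≡count = refl
∣ true  ∷ p ∣≡count = cong suc ∣ p ∣≡count
∣ false ∷ p ∣≡count = ∣ p ∣≡count

∉⇒lookup≡false : ∀ {m} {p : Subset m} {e} → e ∉ˢ p → lookup p e ≡ false
∉⇒lookup≡false {p = p} {e} e∉p with lookup p e in eq
... | false = refl
... | true  = contradiction (lookup⇒[]= e p eq) e∉p

lookup≡false⇒∉ : ∀ {m} {p : Subset m} {e} → lookup p e ≡ false → e ∉ˢ p
lookup≡false⇒∉ eq e∈p = contradiction (trans (sym ([]=⇒lookup e∈p)) eq) λ ()

indicator : Bool → ℕ
indicator b = if b then 1 else 0

module Reduction {q n : ℕ} (I : GMWCT q n) where
  open GMWCT I
  open Labels q
  open Solutions T

  terminal : Fin q → Fin n → ℕ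
  terminal i v = indicator (lookup (S i) v)

  terminal≤1 : ∀ i v → terminal i v ≤ 1
  terminal≤1 i v with lookup (S i) v
  ... | true  = ≤-refl
  ... | false = z≤n

  Own : Fin n → Label → Set
  Own v x = ∀ i → bit x i ≡ terminal i v

  own : ∀ v → ∃ (Own v)
  own v = code (λ i → terminal i v) , λ i → bit-code (λ i → terminal i v) i (terminal≤1 i v)

  module _ (F : Fin n → Label → ℕ) (free : ∀ {v x} → Own v x → F v x ≡ 0)
           (forced : ∀ {v x} → F v x ≤ k → Own v x) where

    -- Own labels are free, and those of two vertices are disjoint exactly when no class contains
    -- both. Separation of terminals thus becomes disjointness of labels within components.
    yes⇒solution : YesInstance I → Solution k (const true) F
    yes⇒solution (E′ , E′≤k , separated) = record
      { cut      = lookup E′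
      ; label    = proj₁ ∘ own
      ; cheap    = ≤-trans (≤-reflexive (trans
          (cong₂ _+_ (sym ∣ E′ ∣≡count) (sum-zero (λ v → F v (proj₁ (own v))) λ v → free (proj₂ (own v))))
          (+-identityʳ _))) E′≤k
      ; disjoint = λ {u} {v} u≢v s i →
          subst₂ (λ x y → x + y ≤ 1) (sym (proj₂ (own u) i)) (sym (proj₂ (own v) i)) (apart u≢v s i) }
      where
      apart : ∀ {u v} → u ≢ v → Star (Kept (const true) (lookup E′)) u v → ∀ i → terminal i u + terminal i v ≤ 1
      apart {u} {v} u≢v s i with lookup (S i) u in u∈ | lookup (S i) v in v∈
      ... | false | false = z≤n
      ... | false | true  = ≤-refl
      ... | true  | false = ≤-refl
      ... | true  | true  = contradiction
            (star⇒path (Star.gmap (λ w → w) (λ (e , _ , Ce , j) → e , lookup≡false⇒∉ Ce , j) s))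
            (separated i (lookup⇒[]= u (S i) u∈) (lookup⇒[]= v (S i) v∈) u≢v)

    -- The budget bounds every single entry by `k`, so `forced` leaves each vertex no label but its
    -- own.
    solution⇒yes : Solution k (const true) F → YesInstance I
    solution⇒yes sol = tabulate cut , E′≤k , separated
      where
      open Solution sol
      E′≤k : ∣ tabulate cut ∣ ≤ k
      E′≤k = ≤-trans (≤-reflexive (trans ∣ tabulate cut ∣≡count
               (sum-cong-≗ λ e → cong indicator (lookup∘tabulate cut e)))) (≤-trans (m≤m+n _ _) cheap)
      owned : ∀ v → Own v (label v)
      owned v = forced (≤-trans (≤-sum (λ v → F v (label v)) v) (≤-trans (m≤n+m _ _) cheap))
      separated : ∀ i {u v} → u ∈ˢ S i → v ∈ˢ S i → u ≢ v →
                  ¬ ∃ λ vs → IsPath (AdjacentWithout (tabulate cut)) u v vs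
      separated i {u} {v} u∈ v∈ u≢v path = contradiction
        (subst₂ (λ x y → x + y ≤ 1) (at u∈) (at v∈) (disjoint u≢v (Star.gmap (λ w → w) keep (path⇒star path)) i))
        λ { (s≤s ()) }
        where
        at : ∀ {w} → w ∈ˢ S i → bit (label w) i ≡ 1
        at {w} w∈ = trans (owned w i) (cong indicator ([]=⇒lookup w∈))
        keep : ∀ {v w} → AdjacentWithout (tabulate cut) v w → Kept (const true) cut v w
        keep (e , e∉ , j) = e , refl , trans (sym (lookup∘tabulate cut e)) (∉⇒lookup≡false e∉) , j

  module _ {A : Fin size → Bool} {F : Fin n → Label → ℕ} (best : Fin n → ℕ)
           (lower : ∀ v x → best v ≤ F v x) (attained : ∀ v → best v ≤ k → ∃ λ x → best v ≡ F v x) where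

    solution⇒best : Solution k A F → sum best ≤ k
    solution⇒best sol = ≤-trans (sum-mono-≤ λ v → lower v (label v)) (≤-trans (m≤n+m _ _) cheap)
      where open Solution sol

    -- Without alive edges distinct vertices are never connected, so disjointness is vacuous and
    -- each vertex takes a cheapest label independently of the others.
    best⇒solution : (∀ e → A e ≡ false) → sum best ≤ k → Solution k A F
    best⇒solution edgeless ∑≤k = record
      { cut      = const false
      ; label    = proj₁ ∘ choice
      ; cheap    = ≤-trans (≤-reflexive (cong₂ _+_
          (sum-zero {size} (const 0) λ _ → refl) (sum-cong-≗ λ v → sym (proj₂ (choice v))))) ∑≤k
      ; disjoint = λ u≢v s → contradiction
          (stranded (λ (e , Ae , _) → contradiction (trans (sym Ae) (edgeless e)) λ ()) s) u≢v }
      where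
      choice : ∀ v → ∃ λ x → best v ≡ F v x
      choice v = attained v (≤-trans (≤-sum best v) ∑≤k)

-- Running programs

LoopFree : Program → Set
LoopFree skip           = ⊤
LoopFree (r ≔ e)        = ⊤
LoopFree (store a e)    = ⊤
LoopFree (P ⨾ Q)        = LoopFree P × LoopFree Q
LoopFree (branch b P Q) = LoopFree P × LoopFree Q
LoopFree (while b P)    = ⊥

-- The final state as a function, meant for loop-free programs; the clause for `while` is a
-- placeholder that `run-loopFree` never meets.
exec : Program → State → State
exec skip           σ = σ
exec (r ≔ e)        σ = ⟨ reg σ [ r ↦ eval e σ ] , mem σ ⟩
exec (store a e)    σ = ⟨ reg σ , mem σ [ eval a σ ↦ eval e σ ] ⟩
exec (P ⨾ Q)        σ = exec Q (exec P σ)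
exec (branch b P Q) σ = if test b σ then exec P σ else exec Q σ
exec (while b P)    σ = σ

-- A branch is charged for both alternatives. The bound is crude but independent of the state, so
-- one round of a loop takes constant time.
bound : Program → ℕ
bound skip           = 1
bound (r ≔ e)        = suc (cost e)
bound (store a e)    = suc (cost a + cost e)
bound (P ⨾ Q)        = bound P + bound Q
bound (branch b P Q) = testCost b + (bound P + bound Q)
bound (while b P)    = 0

record Achieves (P : Program) (σ : State) (b : ℕ) (Φ : State → Set) : Set where
  field
    {time}  : ℕ
    {final} : State
    halts   : Run P σ time final
    timely  : time ≤ b
    post    : Φ final

run-loopFree : ∀ P → LoopFree P → ∀ σ → ∃ λ t → Run P σ t (exec P σ) × t ≤ bound P
run-loopFree skip        _       σ = _ , skip , ≤-refl
run-loopFree (r ≔ e)     _       σ = _ , assign , ≤-refl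
run-loopFree (store a e) _       σ = _ , store , ≤-refl
run-loopFree (P ⨾ Q)     (p , q) σ
  with _ , run₁ , t₁≤ ← run-loopFree P p σ | _ , run₂ , t₂≤ ← run-loopFree Q q (exec P σ) =
  _ , seq run₁ run₂ , +-mono-≤ t₁≤ t₂≤
run-loopFree (branch b P Q) (p , q) σ with test b σ in eq
... | true  with _ , run , t≤ ← run-loopFree P p σ =
      _ , if-true eq run , +-monoʳ-≤ (testCost b) (≤-trans t≤ (m≤m+n _ _))
... | false with _ , run , t≤ ← run-loopFree Q q σ =
      _ , if-false eq run , +-monoʳ-≤ (testCost b) (≤-trans t≤ (m≤n+m _ _))

achieves-exec : ∀ P → LoopFree P → ∀ {σ} {Φ : State → Set} → Φ (exec P σ) → Achieves P σ (bound P) Φ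
achieves-exec P free {σ} {Φ} φ with t , run , t≤ ← run-loopFree P free σ =
  record { halts = run ; timely = t≤ ; post = φ }

achieves-⨾ : ∀ {P Q σ b₁ b₂} {Φ Ψ : State → Set} → Achieves P σ b₁ Φ →
             (∀ {σ′} → Φ σ′ → Achieves Q σ′ b₂ Ψ) → Achieves (P ⨾ Q) σ (b₁ + b₂) Ψ
achieves-⨾ p q = record
  { halts  = seq (halts p) (halts (q (post p)))
  ; timely = +-mono-≤ (timely p) (timely (q (post p)))
  ; post   = post (q (post p)) }
  where open Achieves

-- Every round pays for one test and the body and lowers the measure; the additional `testCost b`
-- pays for the final test that fails.
achieves-while : ∀ {b P} (Inv : State → ℕ → Set) → LoopFree P →
  (∀ {σ μ} → Inv σ μ → test b σ ≡ true → ∃ λ μ′ → μ′ < μ × Inv (exec P σ) μ′) →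
  ∀ {σ μ} → Inv σ μ →
  Achieves (while b P) σ (μ * (testCost b + bound P) + testCost b) (λ σ′ → test b σ′ ≡ false × ∃ (Inv σ′))
achieves-while {b} {P} Inv free step {μ = μ} = go μ ≤-refl
  where
  c = testCost b + bound P
  -- The measure may drop by more than one, so the recursion is on an upper bound for it.
  go : ∀ {σ} fuel {μ} → μ ≤ fuel → Inv σ μ →
       Achieves (while b P) σ (μ * c + testCost b) (λ σ′ → test b σ′ ≡ false × ∃ (Inv σ′))
  go {σ} fuel {μ} μ≤ inv with test b σ in eq
  ... | false = record { halts = while-stop eq ; timely = m≤n+m _ (μ * c) ; post = eq , _ , inv }
  ... | true  with step inv eq
  go zero z≤n inv | true | _ , () , _
  go {σ} (suc fuel) {μ} μ≤ inv | true | μ′ , μ′<μ , inv′ = record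
    { halts  = while-step eq (halts once) (halts rest)
    ; timely = begin
        testCost b + time once + time rest          ≤⟨ +-mono-≤ (+-monoʳ-≤ (testCost b) (timely once)) (timely rest) ⟩
        c + (μ′ * c + testCost b)                   ≡⟨ +-assoc c (μ′ * c) _ ⟨
        suc μ′ * c + testCost b                     ≤⟨ +-monoˡ-≤ (testCost b) (*-monoˡ-≤ c μ′<μ) ⟩
        μ * c + testCost b                          ∎
    ; post   = post rest }
    where
    open Achieves
    open ≤-Reasoning
    once : Achieves P σ (bound P) (_≡ exec P σ)
    once = achieves-exec P free refl
    rest : Achieves (while b P) (final once) (μ′ * c + testCost b) (λ σ′ → test b σ′ ≡ false × ∃ (Inv σ′))
    rest rewrite post once = go fuel (≤-pred (≤-trans μ′<μ μ≤)) inv′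

-- Unrolled loops and compound expressions

each : ∀ {m} → (Fin m → Program) → Program
each {zero}  P = skip
each {suc m} P = P zero ⨾ each (P ∘ suc)

each-loopFree : ∀ {m} (P : Fin m → Program) → (∀ x → LoopFree (P x)) → LoopFree (each P)
each-loopFree {zero}  P free = _
each-loopFree {suc m} P free = free zero , each-loopFree (P ∘ suc) (free ∘ suc)

each-invariant : ∀ {m} (P : Fin m → Program) (Inv : ℕ → State → Set) →
                 (∀ x {σ} → Inv (toℕ x) σ → Inv (suc (toℕ x)) (exec (P x) σ)) →
                 ∀ {σ} → Inv 0 σ → Inv m (exec (each P) σ)
each-invariant {zero}  P Inv step inv = inv
each-invariant {suc m} P Inv step inv = each-invariant (P ∘ suc) (Inv ∘ suc) (step ∘ suc) (step zero inv)

-- The machine cannot multiply. Repeated addition is affordable because all factors that occur are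
-- bounded in terms of `q`.
times : ℕ → Exp → Exp
times zero    e = lit 0
times (suc c) e = e ⊕ times c e

eval-times : ∀ c e σ → eval (times c e) σ ≡ c * eval e σ
eval-times zero    e σ = refl
eval-times (suc c) e σ = cong (eval e σ +_) (eval-times c e σ)

sumExp : ∀ {m} → (Fin m → Exp) → Exp
sumExp {zero}  f = lit 0
sumExp {suc m} f = f zero ⊕ sumExp (f ∘ suc)

eval-sumExp : ∀ {m} (f : Fin m → Exp) σ → eval (sumExp f) σ ≡ sum λ i → eval (f i) σ
eval-sumExp {zero}  f σ = refl
eval-sumExp {suc m} f σ = cong (eval (f zero) σ +_) (eval-sumExp (f ∘ suc) σ)

minimum : ∀ {m} → ℕ → Vector ℕ m → ℕ
minimum {zero}  b f = b
minimum {suc m} b f = f zero ⊓ minimum b (f ∘ suc)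

minimum-cong : ∀ {m} {b b′} {f f′ : Vector ℕ m} → b ≡ b′ → f ≗ f′ → minimum b f ≡ minimum b′ f′
minimum-cong {zero}  b≡ f≡ = b≡
minimum-cong {suc m} b≡ f≡ = cong₂ _⊓_ (f≡ zero) (minimum-cong b≡ (f≡ ∘ suc))

minimum-≤-base : ∀ {m} b (f : Vector ℕ m) → minimum b f ≤ b
minimum-≤-base {zero}  b f = ≤-refl
minimum-≤-base {suc m} b f = ≤-trans (m⊓n≤n (f zero) _) (minimum-≤-base b (f ∘ suc))

minimum-≤ : ∀ {m} b (f : Vector ℕ m) i → minimum b f ≤ f i
minimum-≤ b f zero    = m⊓n≤m (f zero) _
minimum-≤ b f (suc i) = ≤-trans (m⊓n≤n (f zero) _) (minimum-≤ b (f ∘ suc) i)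

minimum-attained : ∀ {m} b (f : Vector ℕ m) → minimum b f ≡ b ⊎ ∃ λ i → minimum b f ≡ f i
minimum-attained {zero}  b f = inj₁ refl
minimum-attained {suc m} b f with ⊓-sel (f zero) (minimum b (f ∘ suc)) | minimum-attained b (f ∘ suc)
... | inj₁ eq | _              = inj₂ (zero , eq)
... | inj₂ eq | inj₁ eq′       = inj₁ (trans eq eq′)
... | inj₂ eq | inj₂ (i , eq′) = inj₂ (suc i , trans eq eq′)

-- The minimum of two numbers is `m ∸ (m ∸ n)`. Each candidate is duplicated but the tail is not, so
-- the expression does not grow exponentially.
least : ∀ {m} → Exp → (Fin m → Exp) → Exp
least {zero}  b f = b
least {suc m} b f = f zero ⊖ (f zero ⊖ least b (f ∘ suc))

m∸[m∸n]≡m⊓n : ∀ m n → m ∸ (m ∸ n) ≡ m ⊓ n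
m∸[m∸n]≡m⊓n m n with ≤-total m n
... | inj₁ m≤n = trans (cong (m ∸_) (m≤n⇒m∸n≡0 m≤n)) (sym (m≤n⇒m⊓n≡m m≤n))
... | inj₂ n≤m = trans (m∸[m∸n]≡n n≤m) (sym (m≥n⇒m⊓n≡n n≤m))

eval-least : ∀ {m} b (f : Fin m → Exp) σ → eval (least b f) σ ≡ minimum (eval b σ) (λ i → eval (f i) σ)
eval-least {zero}  b f σ = refl
eval-least {suc m} b f σ = trans (m∸[m∸n]≡m⊓n (eval (f zero) σ) _)
                                 (cong (eval (f zero) σ ⊓_) (eval-least b (f ∘ suc) σ))

-- Memory updates and lists of blocks

↦-same : ∀ (f : ℕ → ℕ) {a b} x → a ≡ b → (f [ a ↦ x ]) b ≡ x
↦-same f {a} x refl rewrite ≡ᵇ-refl a = refl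

↦-other : ∀ (f : ℕ → ℕ) {a b} x → a ≢ b → (f [ a ↦ x ]) b ≡ f b
↦-other f x a≢b rewrite ≢⇒≡ᵇ a≢b = refl

contents-++ʳ : ∀ xs ys a → contents (xs ++ ys) (length xs + a) ≡ contents ys a
contents-++ʳ []       ys a = refl
contents-++ʳ (x ∷ xs) ys a = contents-++ʳ xs ys a

contents-++ˡ : ∀ xs ys {a} → a < length xs → contents (xs ++ ys) a ≡ contents xs a
contents-++ˡ (x ∷ xs) ys {zero}  _       = refl
contents-++ˡ (x ∷ xs) ys {suc a} (s≤s a<) = contents-++ˡ xs ys a<

contents-beyond : ∀ xs a → contents xs (length xs + a) ≡ 0
contents-beyond []       a = refl
contents-beyond (x ∷ xs) a = contents-beyond xs a

module _ {w : ℕ} where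

  length-blocks : ∀ {m} (f : Fin m → List ℕ) → (∀ i → length (f i) ≡ w) →
                  length (concat (List.tabulate f)) ≡ m * w
  length-blocks {zero}  f len = refl
  length-blocks {suc m} f len =
    trans (length-++ (f zero)) (cong₂ _+_ (len zero) (length-blocks (f ∘ suc) (len ∘ suc)))

  contents-blocks : ∀ {m} (f : Fin m → List ℕ) → (∀ i → length (f i) ≡ w) → ∀ i {j} → j < w →
                    contents (concat (List.tabulate f)) (toℕ i * w + j) ≡ contents (f i) j
  contents-blocks f len zero    {j} j<w = contents-++ˡ (f zero) _ (subst (j <_) (sym (len zero)) j<w)
  contents-blocks f len (suc i) {j} j<w = begin
    contents (f zero ++ rest) (w + toℕ i * w + j)                 ≡⟨ cong (contents (f zero ++ rest)) (+-assoc w _ j) ⟩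
    contents (f zero ++ rest) (w + (toℕ i * w + j))               ≡⟨ cong (λ ℓ → contents (f zero ++ rest) (ℓ + (toℕ i * w + j))) (len zero) ⟨
    contents (f zero ++ rest) (length (f zero) + (toℕ i * w + j)) ≡⟨ contents-++ʳ (f zero) rest _ ⟩
    contents rest (toℕ i * w + j)                                 ≡⟨ contents-blocks (f ∘ suc) (len ∘ suc) i j<w ⟩
    contents (f (suc i)) j                                        ∎
    where
    open ≡-Reasoning
    rest = concat (List.tabulate (f ∘ suc))

-- The program

module Algorithm (q : ℕ) where
  open Labels q

  width : ℕ
  width = 2 + 2 ^ q

  Field : Set
  Field = Fin width

  pattern deg   = zero
  pattern nbr   = suc zero
  pattern tab x = suc (suc x)

  N E K ∞ : Exp
  N = load (lit 0)
  E = load (lit 1)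
  K = load (lit 2)
  ∞ = lit 1 ⊕ K

  -- The input is followed by a record for every vertex: its degree, the sum of its neighbours
  -- and its table of costs.
  opaque
    slot : Exp → Field → Exp
    slot v j = lit 3 ⊕ times 2 E ⊕ times q N ⊕ (times width v ⊕ lit (toℕ j))

  cell : Exp → Field → Exp
  cell v j = load (slot v j)

  increase decrease : Exp → Field → Exp → Program
  increase v j e = store (slot v j) (cell v j ⊕ e)
  decrease v j e = store (slot v j) (cell v j ⊖ e)

  module _ (k : ℕ) (f g : Label → ℕ) (c : Label) where

    mergeCost : Label → Label → ℕ
    mergeCost a b = if does (merge? a b c) then f a + g b else suc k

    cutCost : Label → ℕ
    cutCost b = f c + suc (g b)

    mergeBest : Label → ℕ
    mergeBest a = minimum (suc k) (mergeCost a)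

    relax : ℕ
    relax = minimum (minimum (suc k) cutCost) mergeBest

  module _ (f g : Label → Exp) (c : Label) where

    -- `merge?` is decided while the program is built, not by a test at run time. Pairs that do not
    -- unite to `c` contribute only the cap.
    mergeExp : Label → Label → Exp
    mergeExp a b = if does (merge? a b c) then f a ⊕ g b else ∞

    cutExp : Label → Exp
    cutExp b = f c ⊕ (lit 1 ⊕ g b)

    relaxExp : Exp
    relaxExp = least (least ∞ cutExp) λ a → least ∞ (mergeExp a)

  eval-relaxExp : ∀ {k} (f g : Label → Exp) {f′ g′ : Label → ℕ} σ → eval K σ ≡ k →
                  (∀ x → eval (f x) σ ≡ f′ x) → (∀ x → eval (g x) σ ≡ g′ x) →
                  ∀ c → eval (relaxExp f g c) σ ≡ relax k f′ g′ c
  eval-relaxExp {k} f g {f′} {g′} σ K≡ f≡ g≡ c =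
    trans (eval-least (least ∞ (cutExp f g c)) (λ a → least ∞ (mergeExp f g c a)) σ) $ minimum-cong
      (trans (eval-least ∞ (cutExp f g c) σ)
             (minimum-cong (cong suc K≡) λ b → cong₂ (λ x y → x + suc y) (f≡ c) (g≡ b)))
      λ a → trans (eval-least ∞ (mergeExp f g c a) σ)
                  (minimum-cong (cong suc K≡) λ b → choice (does (merge? a b c)) a b)
    where
    choice : ∀ d a b → eval (if d then f a ⊕ g b else ∞) σ ≡ (if d then f′ a + g′ b else suc k)
    choice true  a b = cong₂ _+_ (f≡ a) (g≡ b)
    choice false a b = cong suc K≡

  -- The cap `suc k` is among the values minimised, so only an entry of at most `k` is sure to come
  -- from a merge or a cut; this is all that `attained` promises.
  relax-relaxed : ∀ k f g → Relaxed k f g (relax k f g)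
  relax-relaxed k f g = record
    { below-merge = λ {a} {b} {c} μ → begin
        relax k f g c            ≤⟨ minimum-≤ _ (mergeBest k f g c) a ⟩
        mergeBest k f g c a      ≤⟨ minimum-≤ (suc k) (mergeCost k f g c a) b ⟩
        mergeCost k f g c a b    ≡⟨ cong (if_then f a + g b else suc k) (dec-true (merge? a b c) μ) ⟩
        f a + g b                ∎
    ; below-cut   = λ b c → ≤-trans (minimum-≤-base _ (mergeBest k f g c)) (minimum-≤ (suc k) (cutCost k f g c) b)
    ; attained    = λ c → attained c (minimum-attained (minimum (suc k) (cutCost k f g c)) (mergeBest k f g c)) }
    where
    open ≤-Reasoning
    too-big : ∀ {x} {A : Set} → x ≡ suc k → x ≤ k → A
    too-big refl 1+k≤k = contradiction 1+k≤k 1+n≰n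
    decided : ∀ {P : Set} (P? : Dec P) (x y : ℕ) →
              (P × (if does P? then x else y) ≡ x) ⊎ (if does P? then x else y) ≡ y
    decided (yes p) x y = inj₁ (p , refl)
    decided (no ¬p) x y = inj₂ refl
    attained : ∀ c →
      relax k f g c ≡ minimum (suc k) (cutCost k f g c) ⊎ (∃ λ a → relax k f g c ≡ mergeBest k f g c a) →
      relax k f g c ≤ k →
      (∃₂ λ a b → Merge a b c × relax k f g c ≡ f a + g b) ⊎ (∃ λ b → relax k f g c ≡ f c + suc (g b))
    attained c (inj₁ eq) ≤k with minimum-attained (suc k) (cutCost k f g c)
    ... | inj₁ eq′       = too-big (trans eq eq′) ≤k
    ... | inj₂ (b , eq′) = inj₂ (b , trans eq eq′)
    attained c (inj₂ (a , eq)) ≤k with minimum-attained (suc k) (mergeCost k f g c a)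
    ... | inj₁ eq′ = too-big (trans eq eq′) ≤k
    ... | inj₂ (b , eq′) with decided (merge? a b c) (f a + g b) (suc k)
    ...   | inj₁ (μ , eq″) = inj₁ (a , b , μ , trans eq (trans eq′ eq″))
    ...   | inj₂ eq″       = too-big (trans eq (trans eq′ eq″)) ≤k

  terminalExp : Fin q → Exp
  terminalExp i = load (lit 3 ⊕ times 2 E ⊕ (times (toℕ i) N ⊕ var 1))

  -- The Hamming distance between `x` and the set of classes of the vertex in register 1, each
  -- absolute difference being the sum of two truncated ones.
  mismatch : Label → Exp
  mismatch x = sumExp λ i → (terminalExp i ⊖ lit (bit x i)) ⊕ (lit (bit x i) ⊖ terminalExp i)

  next : Program
  next = 1 ≔ lit 1 ⊕ var 1

  -- Register 1 counts edges or vertices; registers 2 and 3 hold the two ends of an edge.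
  addEdge : Program
  addEdge =
    2 ≔ load (lit 3 ⊕ times 2 (var 1)) ⨾
    3 ≔ load (lit 4 ⊕ times 2 (var 1)) ⨾
    increase (var 2) deg (lit 1) ⨾
    increase (var 3) deg (lit 1) ⨾
    increase (var 2) nbr (var 3) ⨾
    increase (var 3) nbr (var 2) ⨾
    next

  setCost : Label → Program
  setCost x = branch (mismatch x ≈ lit 0) (store (slot (var 1) (tab x)) (lit 0)) (store (slot (var 1) (tab x)) ∞)

  setCosts : Program
  setCosts = each setCost ⨾ next

  -- All costs of the parent are computed into registers before any of them is overwritten.
  scratch : Label → ℕ
  scratch x = 4 + toℕ x

  relaxParent : Label → Program
  relaxParent x = scratch x ≔ relaxExp (λ y → cell (var 3) (tab y)) (λ y → cell (var 2) (tab y)) x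

  setParent : Label → Program
  setParent x = store (slot (var 3) (tab x)) (var (scratch x))

  -- A zero table makes the removed leaf free under every label, so that it adds nothing to the
  -- final sum of minima.
  clearLeaf : Label → Program
  clearLeaf x = store (slot (var 2) (tab x)) (lit 0)

  removeEdge : Program
  removeEdge =
    decrease (var 2) deg (lit 1) ⨾
    decrease (var 3) deg (lit 1) ⨾
    decrease (var 2) nbr (var 3) ⨾
    decrease (var 3) nbr (var 2) ⨾
    2 ≔ var 3

  prune : Program
  prune = 3 ≔ cell (var 2) nbr ⨾ each relaxParent ⨾ each setParent ⨾ each clearLeaf ⨾ removeEdge

  advance : Program
  advance = next ⨾ 2 ≔ var 1

  pruneOrAdvance : Program
  pruneOrAdvance = branch (cell (var 2) deg ≈ lit 1) prune advance

  addBest : Program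
  addBest = 0 ≔ var 0 ⊕ least ∞ (λ x → cell (var 1) (tab x)) ⨾ next

  readEdges initialise pruneLeaves sumBest verdict program : Program
  readEdges   = while (var 1 ≺ E) addEdge
  initialise  = 1 ≔ lit 0 ⨾ while (var 1 ≺ N) setCosts
  pruneLeaves = (1 ≔ lit 0 ⨾ 2 ≔ lit 0) ⨾ while (var 1 ≺ N) pruneOrAdvance
  sumBest     = (1 ≔ lit 0 ⨾ 0 ≔ lit 0) ⨾ while (var 1 ≺ N) addBest
  verdict     = branch (var 0 ≺ ∞) (0 ≔ lit 1) (0 ≔ lit 0)
  program     = readEdges ⨾ initialise ⨾ pruneLeaves ⨾ sumBest ⨾ verdict

  loopConstant : ℕ → Exp → Program → ℕ
  loopConstant d limit P = d * (testCost (var 1 ≺ limit) + bound P) + testCost (var 1 ≺ limit)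

  -- The first argument of `loopConstant` bounds the rounds per vertex: it is 2 for pruning, which
  -- takes at most `n + size` rounds. The summands 2 and 4 are the times for resetting one or two
  -- registers.
  timeConstant : ℕ
  timeConstant = loopConstant 1 E addEdge + (2 + loopConstant 1 N setCosts +
    (4 + loopConstant 2 N pruneOrAdvance + (4 + loopConstant 1 N addBest + bound verdict)))

  prune-loopFree : LoopFree prune
  prune-loopFree = _ , each-loopFree relaxParent _ , each-loopFree setParent _ , each-loopFree clearLeaf _ , _

  -- Memory layout and its invariants

  module Memory {n : ℕ} (I : GMWCT q n) where
    open GMWCT I
    open Reduction I

    input : ℕ → ℕ
    input = contents (encode I)

    opaque
      inputLength : ℕ
      inputLength = 3 + 2 * size + q * n

      address : ℕ → Field → ℕ
      address v j = inputLength + (v * width + toℕ j)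

    private
      edgeBlock : Fin size → List ℕ
      edgeBlock e = toℕ (proj₁ (ends e)) ∷ toℕ (proj₂ (ends e)) ∷ []

      classBlock : Fin q → List ℕ
      classBlock i = List.map indicator (Vec.toList (S i))

      classBlock-length : ∀ i → length (classBlock i) ≡ n
      classBlock-length i = trans (length-map indicator (Vec.toList (S i))) (length-toList (S i))

      contents-map : ∀ {m} (f : Bool → ℕ) (p : Vec.Vec Bool m) v →
                     contents (List.map f (Vec.toList p)) (toℕ v) ≡ f (lookup p v)
      contents-map f (b ∷ p) zero    = refl
      contents-map f (b ∷ p) (suc v) = contents-map f p v

      edges classes : List ℕ
      edges   = concat (List.tabulate edgeBlock)
      classes = concat (List.tabulate classBlock)

      edges-length : length edges ≡ size * 2
      edges-length = length-blocks edgeBlock λ _ → refl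

      after-edges : ∀ a → input (3 + 2 * size + a) ≡ contents classes a
      after-edges a = trans (cong (λ ℓ → contents (edges ++ classes) (ℓ + a)) (trans (*-comm 2 size) (sym edges-length)))
                            (contents-++ʳ edges classes a)

    input-ends : ∀ e → input (3 + 2 * toℕ e) ≡ toℕ (proj₁ (ends e)) × input (4 + 2 * toℕ e) ≡ toℕ (proj₂ (ends e))
    input-ends e = at₀ , at₁
      where
      inside : ∀ {j} → j < 2 → toℕ e * 2 + j < length edges
      inside {j} j<2 = subst (toℕ e * 2 + j <_) (sym edges-length)
        (≤-trans (+-monoʳ-< (toℕ e * 2) j<2) (≤-trans (≤-reflexive (+-comm (toℕ e * 2) 2)) (*-monoˡ-≤ 2 (toℕ<n e))))
      block : ∀ {j} → j < 2 → input (3 + (toℕ e * 2 + j)) ≡ contents (edgeBlock e) j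
      block j<2 = trans (contents-++ˡ edges classes (inside j<2)) (contents-blocks edgeBlock (λ _ → refl) e j<2)
      at₀ : input (3 + 2 * toℕ e) ≡ toℕ (proj₁ (ends e))
      at₀ = trans (cong (input ∘ (3 +_)) (trans (*-comm 2 (toℕ e)) (sym (+-identityʳ _)))) (block (s≤s z≤n))
      at₁ : input (4 + 2 * toℕ e) ≡ toℕ (proj₂ (ends e))
      at₁ = trans (cong (input ∘ (3 +_)) (trans (cong suc (*-comm 2 (toℕ e))) (+-comm 1 _))) (block (s≤s (s≤s z≤n)))

    input-terminal : ∀ i v → input (3 + 2 * size + (toℕ i * n + toℕ v)) ≡ terminal i v
    input-terminal i v = trans (after-edges _)
      (trans (contents-blocks classBlock classBlock-length i (toℕ<n v)) (contents-map indicator (S i) v))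

    opaque
      unfolding address

      header<inputLength : ∀ {a} → a < 3 → a < inputLength
      header<inputLength a<3 = ≤-trans a<3 (≤-trans (m≤m+n 3 (2 * size)) (m≤m+n _ (q * n)))

      ends<inputLength : ∀ (e : Fin size) → 4 + 2 * toℕ e < inputLength
      ends<inputLength e = s≤s (s≤s (s≤s (≤-trans
        (≤-reflexive (sym (*-suc 2 (toℕ e)))) (≤-trans (*-monoʳ-≤ 2 (toℕ<n e)) (m≤m+n _ (q * n))))))

      terminal<inputLength : ∀ (i : Fin q) (v : Fin n) → 3 + 2 * size + (toℕ i * n + toℕ v) < inputLength
      terminal<inputLength i v = +-monoʳ-< (3 + 2 * size) (≤-trans (+-monoʳ-< (toℕ i * n) (toℕ<n v))
        (≤-trans (≤-reflexive (+-comm (toℕ i * n) n)) (*-monoˡ-≤ n (toℕ<n i))))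

      inputLength≤address : ∀ v j → inputLength ≤ address v j
      inputLength≤address v j = m≤m+n inputLength _

      input-beyond : ∀ v j → input (address v j) ≡ 0
      input-beyond v j = trans (cong input (+-assoc (3 + 2 * size) (q * n) a)) (trans (after-edges _)
        (trans (cong (λ ℓ → contents classes (ℓ + a)) (sym (length-blocks classBlock classBlock-length)))
               (contents-beyond classes a)))
        where
        a : ℕ
        a = v * width + toℕ j

      -- Uniqueness of division with remainder, as field numbers are below `width`.
      address-injective : ∀ {v v′ j j′} → address v j ≡ address v′ j′ → v ≡ v′ × j ≡ j′
      address-injective {v} {v′} {j} {j′} eq = map₂ toℕ-injective (go v v′ (+-cancelˡ-≡ inputLength _ _ eq))
        where
        go : ∀ v v′ → v * width + toℕ j ≡ v′ * width + toℕ j′ → v ≡ v′ × toℕ j ≡ toℕ j′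
        go zero    zero     eq = refl , eq
        go zero    (suc v′) eq = contradiction (toℕ<n j)
          (≤⇒≯ (≤-trans (≤-trans (m≤m+n width _) (m≤m+n _ _)) (≤-reflexive (sym eq))))
        go (suc v) zero     eq = contradiction (toℕ<n j′)
          (≤⇒≯ (≤-trans (≤-trans (m≤m+n width _) (m≤m+n _ _)) (≤-reflexive eq)))
        go (suc v) (suc v′) eq = map₁ (cong suc) (go v v′ (+-cancelˡ-≡ width _ _
          (trans (sym (+-assoc width (v * width) _)) (trans eq (+-assoc width (v′ * width) _)))))

    Fields : Set
    Fields = Field → Fin n → ℕ

    -- All writing happens behind the input, so the numbers in its header, from which addresses and
    -- the cap are computed, stay readable throughout.
    Intact : (ℕ → ℕ) → Set
    Intact μ = ∀ {a} → a < inputLength → μ a ≡ input a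

    record Represents (μ : ℕ → ℕ) (H : Fields) : Set where
      field
        intact : Intact μ
        stored : ∀ j v → μ (address (toℕ v) j) ≡ H j v

    open Represents public

    -- Memory behind the input is zero, so the degrees and neighbour sums start correct before any
    -- edge is read.
    represents-initial : Represents input λ _ _ → 0
    represents-initial = record { intact = λ _ → refl ; stored = λ j v → input-beyond (toℕ v) j }

    put : Field → ℕ → ℕ → Fields → Fields
    put j u y H j′ v = if toℕ j ≡ᵇ toℕ j′ then (if u ≡ᵇ toℕ v then y else H j′ v) else H j′ v

    represents-put : ∀ {μ H} → Represents μ H → ∀ j u y → Represents (μ [ address u j ↦ y ]) (put j u y H)
    represents-put {μ} {H} ρ j u y = record
      { intact = λ {a} a< → trans (↦-other μ {address u j} {a} y λ { refl → <⇒≱ a< (inputLength≤address u j) }) (intact ρ a<)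
      ; stored = stored′ }
      where
      stored′ : ∀ j′ v → (μ [ address u j ↦ y ]) (address (toℕ v) j′) ≡ put j u y H j′ v
      stored′ j′ v with toℕ j ≟ℕ toℕ j′
      ... | no j≢j′ rewrite ≢⇒≡ᵇ j≢j′ =
            trans (↦-other μ y (j≢j′ ∘ cong toℕ ∘ proj₂ ∘ address-injective {u} {toℕ v})) (stored ρ j′ v)
      ... | yes j≡j′ with refl ← toℕ-injective j≡j′ with u ≟ℕ toℕ v
      ...   | yes refl rewrite ≡ᵇ-refl (toℕ j) | ≡ᵇ-refl (toℕ v) = ↦-same μ y refl
      ...   | no u≢v   rewrite ≡ᵇ-refl (toℕ j) | ≢⇒≡ᵇ u≢v =
              trans (↦-other μ y (u≢v ∘ proj₁ ∘ address-injective {u} {toℕ v} {j} {j})) (stored ρ j v)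

    represents-≗ : ∀ {μ H H′} → Represents μ H → (∀ j v → H j v ≡ H′ j v) → Represents μ H′
    represents-≗ ρ H≡ = record { intact = intact ρ ; stored = λ j v → trans (stored ρ j v) (H≡ j v) }

    module _ {σ : State} (ι : Intact (mem σ)) where

      eval-N : eval N σ ≡ n
      eval-N = ι (header<inputLength (s≤s z≤n))

      eval-E : eval E σ ≡ size
      eval-E = ι (header<inputLength (s≤s (s≤s z≤n)))

      eval-K : eval K σ ≡ k
      eval-K = ι (header<inputLength (s≤s (s≤s (s≤s z≤n))))

      opaque
        unfolding address slot

        eval-slot : ∀ v j → eval (slot v j) σ ≡ address (eval v σ) j
        eval-slot v j = cong₂ _+_
          (cong₂ (λ x y → 3 + x + y) (trans (eval-times 2 E σ) (cong (2 *_) eval-E))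
                                     (trans (eval-times q N σ) (cong (q *_) eval-N)))
          (cong (_+ toℕ j) (trans (eval-times width v σ) (*-comm width (eval v σ))))

    eval-cell : ∀ {σ H} → Represents (mem σ) H → ∀ e j {v} → eval e σ ≡ toℕ v → eval (cell e j) σ ≡ H j v
    eval-cell {σ} ρ e j {v} e≡ =
      trans (cong (mem σ) (trans (eval-slot {σ} (intact ρ) e j) (cong (λ u → address u j) e≡))) (stored ρ j v)

    -- The change is expressed by `δ`, so that adding or removing both ends of an edge yields the
    -- very sums that define `incidence` and `opposite`.
    adjust : (ℕ → ℕ → ℕ) → Field → ℕ → ℕ → Fields → Fields
    adjust _·_ j u x H j′ v = if toℕ j ≡ᵇ toℕ j′ then H j′ v · δ u (toℕ v) x else H j′ v

    private
      represents-adjust : ∀ (_·_ : ℕ → ℕ → ℕ) → (∀ y → y · 0 ≡ y) → ∀ {σ H} → Represents (mem σ) H → ∀ e j x →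
        Represents (mem σ [ eval (slot e j) σ ↦ mem σ (eval (slot e j) σ) · x ]) (adjust _·_ j (eval e σ) x H)
      represents-adjust _·_ ·0 {σ} {H} ρ e j x rewrite eval-slot {σ} (intact ρ) e j =
        represents-≗ (represents-put ρ j (eval e σ) _) pointwise
        where
        pointwise : ∀ j′ v → put j (eval e σ) (mem σ (address (eval e σ) j) · x) H j′ v
                           ≡ adjust _·_ j (eval e σ) x H j′ v
        pointwise j′ v with toℕ j ≟ℕ toℕ j′
        ... | no j≢j′ rewrite ≢⇒≡ᵇ j≢j′ = refl
        ... | yes j≡j′ with refl ← toℕ-injective j≡j′ with eval e σ ≟ℕ toℕ v
        ...   | yes u≡v rewrite ≡ᵇ-refl (toℕ j) | u≡v | ≡ᵇ-refl (toℕ v) = cong (_· x) (stored ρ j v)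
        ...   | no  u≢v rewrite ≡ᵇ-refl (toℕ j) | ≢⇒≡ᵇ u≢v = sym (·0 _)

    represents-increase : ∀ {σ H} → Represents (mem σ) H → ∀ v j e →
      Represents (mem (exec (increase v j e) σ)) (adjust _+_ j (eval v σ) (eval e σ) H)
    represents-increase {σ} ρ v j e = represents-adjust _+_ +-identityʳ ρ v j (eval e σ)

    represents-decrease : ∀ {σ H} → Represents (mem σ) H → ∀ v j e →
      Represents (mem (exec (decrease v j e) σ)) (adjust _∸_ j (eval v σ) (eval e σ) H)
    represents-decrease {σ} ρ v j e = represents-adjust _∸_ (λ _ → refl) ρ v j (eval e σ)

    overwrite : ℕ → (Label → ℕ) → Fields → Fields
    overwrite u f H deg     v = H deg v
    overwrite u f H nbr     v = H nbr v
    overwrite u f H (tab x) v = if u ≡ᵇ toℕ v then f x else H (tab x) v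

    -- The tables change from one store to the next, so the effect of each store has to be
    -- predictable from the registers and the input alone.
    each-store : ∀ {σ H} → Represents (mem σ) H → ∀ {u} (f : Label → ℕ) (P : Label → Program) →
      (∀ x {σ′} → reg σ′ ≡ reg σ → Intact (mem σ′) → exec (P x) σ′ ≡ ⟨ reg σ′ , mem σ′ [ address u (tab x) ↦ f x ] ⟩) →
      reg (exec (each P) σ) ≡ reg σ × Represents (mem (exec (each P) σ)) (overwrite u f H)
    each-store {σ} {H} ρ {u} f P effect =
      let regs , ρ′ = each-invariant P Inv step (refl , represents-≗ ρ start) in regs , represents-≗ ρ′ end
      where
      partial : ℕ → Fields
      partial i deg     v = H deg v
      partial i nbr     v = H nbr v
      partial i (tab x) v = if toℕ x <ᵇ i then overwrite u f H (tab x) v else H (tab x) v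
      Inv : ℕ → State → Set
      Inv i σ′ = reg σ′ ≡ reg σ × Represents (mem σ′) (partial i)
      start : ∀ j v → H j v ≡ partial 0 j v
      start deg     v = refl
      start nbr     v = refl
      start (tab x) v = refl
      end : ∀ j v → partial (2 ^ q) j v ≡ overwrite u f H j v
      end deg     v = refl
      end nbr     v = refl
      end (tab x) v rewrite <⇒<ᵇ≡true (toℕ<n x) = refl
      extend : ∀ x j v → put (tab x) u (f x) (partial (toℕ x)) j v ≡ partial (suc (toℕ x)) j v
      extend x deg     v = refl
      extend x nbr     v = refl
      extend x (tab y) v with toℕ x ≟ℕ toℕ y
      ... | yes x≡y with refl ← toℕ-injective x≡y
            rewrite ≡ᵇ-refl (toℕ x) | ≮⇒<ᵇ≡false (n≮n (toℕ x)) | <⇒<ᵇ≡true (n<1+n (toℕ x)) = refl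
      ... | no  x≢y rewrite ≢⇒≡ᵇ x≢y | <ᵇ-suc (x≢y ∘ sym) = refl
      step : ∀ x {σ′} → Inv (toℕ x) σ′ → Inv (suc (toℕ x)) (exec (P x) σ′)
      step x (regs , ρ′) rewrite effect x regs (intact ρ′) = regs , represents-≗ (represents-put ρ′ (tab x) u (f x)) (extend x)

-- Correctness and running time

below : ∀ {m} → ℕ → Fin m → Bool
below i e = toℕ e <ᵇ i

sum-mask-below : ∀ {m} (f : Vector ℕ m) e →
                 sum (mask (below (suc (toℕ e))) f) ≡ sum (mask (below (toℕ e)) f) + f e
sum-mask-below f e = sum-mask-extend {A = below (suc (toℕ e))} {below (toℕ e)} f
  (<⇒<ᵇ≡true (n<1+n (toℕ e))) (≮⇒<ᵇ≡false (n≮n (toℕ e))) λ j j≢e → <ᵇ-suc (j≢e ∘ toℕ-injective)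

mask-below-size : ∀ {m} (f : Vector ℕ m) → sum (mask (below m) f) ≡ sum f
mask-below-size f = sum-cong-≗ λ e → cong (if_then f e else 0) (<⇒<ᵇ≡true (toℕ<n e))

-- The measure is the distance `ℓ ∸ i` of the counter from its limit; a failing test then forces `i`
-- to be `ℓ`.
achieves-for : ∀ {limit ℓ P} (Inv : ℕ → State → Set) → LoopFree P →
  (∀ {i σ} → Inv i σ → eval limit σ ≡ ℓ) →
  (∀ (x : Fin ℓ) {σ} → reg σ 1 ≡ toℕ x → Inv (toℕ x) σ →
     reg (exec P σ) 1 ≡ suc (toℕ x) × Inv (suc (toℕ x)) (exec P σ)) →
  ∀ {σ} → reg σ 1 ≡ 0 → Inv 0 σ →
  Achieves (while (var 1 ≺ limit) P) σ
           (ℓ * (testCost (var 1 ≺ limit) + bound P) + testCost (var 1 ≺ limit)) (Inv ℓ)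
achieves-for {limit} {ℓ} {P} Inv free limit≡ body {σ} r≡0 inv₀ = record
  { halts  = halts loop
  ; timely = timely loop
  ; post   = done (post loop) }
  where
  open Achieves
  Inv′ : State → ℕ → Set
  Inv′ σ μ = ∃ λ i → reg σ 1 ≡ i × i ≤ ℓ × μ ≡ ℓ ∸ i × Inv i σ
  step : ∀ {σ μ} → Inv′ σ μ → test (var 1 ≺ limit) σ ≡ true → ∃ λ μ′ → μ′ < μ × Inv′ (exec P σ) μ′
  step {σ} (_ , refl , _ , refl , inv) continue =
    let i<ℓ    = subst (reg σ 1 <_) (limit≡ inv) (<ᵇ⇒< _ _ (subst Bool.T (sym continue) _))
        x≡     = toℕ-fromℕ< i<ℓ
        r , i′ = body (fromℕ< i<ℓ) (sym x≡) (subst (λ i → Inv i σ) (sym x≡) inv)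
    in ℓ ∸ suc (reg σ 1) , ∸-monoʳ-< (n<1+n _) i<ℓ ,
       (suc (reg σ 1) , trans r (cong suc x≡) , i<ℓ , refl , subst (λ i → Inv (suc i) (exec P σ)) x≡ i′)
  loop : Achieves (while (var 1 ≺ limit) P) σ (ℓ * (testCost (var 1 ≺ limit) + bound P) + testCost (var 1 ≺ limit))
                  (λ σ′ → test (var 1 ≺ limit) σ′ ≡ false × ∃ (Inv′ σ′))
  loop = achieves-while Inv′ free step (0 , r≡0 , z≤n , refl , inv₀)
  done : ∀ {σ} → test (var 1 ≺ limit) σ ≡ false × ∃ (Inv′ σ) → Inv ℓ σ
  done {σ} (stop , _ , _ , refl , i≤ℓ , _ , inv) = subst (λ i → Inv i σ) (≤-antisym i≤ℓ (≮⇒≥ λ i<ℓ →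
    contradiction (trans (sym (<⇒<ᵇ≡true (subst (reg σ 1 <_) (sym (limit≡ inv)) i<ℓ))) stop) λ ())) inv

branch-elim : ∀ b P Q σ (Φ : State → Set) → (test b σ ≡ true → Φ (exec P σ)) →
              (test b σ ≡ false → Φ (exec Q σ)) → Φ (exec (branch b P Q) σ)
branch-elim b P Q σ Φ t f = go (test b σ) t f
  where
  go : ∀ c → (c ≡ true → Φ (exec P σ)) → (c ≡ false → Φ (exec Q σ)) → Φ (if c then exec P σ else exec Q σ)
  go true  t f = t refl
  go false t f = f refl

module Verification {q n : ℕ} (I : GMWCT q n) where
  open GMWCT I
  open Labels q
  open Algorithm q
  open Memory I
  open Reduction I
  open GraphProperties T
  open Solutions T

  record Matches (A : Fin size → Bool) (H : Fields) : Set where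
    field
      degrees    : ∀ w → H deg w ≡ degree A w
      neighbours : ∀ w → H nbr w ≡ neighbourSum A w

  open Matches

  matches-≗ : ∀ {A A′ H} → (∀ e → A e ≡ A′ e) → Matches A H → Matches A′ H
  matches-≗ {A} {A′} A≡ m = record
    { degrees    = λ w → trans (degrees m w) (sum-cong-≗ λ e → cong (if_then incidence e w else 0) (A≡ e))
    ; neighbours = λ w → trans (neighbours m w) (sum-cong-≗ λ e → cong (if_then opposite e w else 0) (A≡ e)) }

  readEdges-achieves : ∀ {σ} → reg σ 1 ≡ 0 → mem σ ≡ input →
    Achieves readEdges σ (size * (testCost (var 1 ≺ E) + bound addEdge) + testCost (var 1 ≺ E))
      (λ σ′ → ∃ λ H → Represents (mem σ′) H × Matches (const true) H)
  readEdges-achieves {σ} r≡0 refl = record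
    { halts  = halts loop
    ; timely = timely loop
    ; post   = let H , ρ , m = post loop in H , ρ , matches-≗ {below size} (λ e → <⇒<ᵇ≡true (toℕ<n e)) m }
    where
    open Achieves
    Inv : ℕ → State → Set
    Inv i σ = ∃ λ H → Represents (mem σ) H × Matches (below i) H
    step : ∀ e {σ} → reg σ 1 ≡ toℕ e → Inv (toℕ e) σ →
           reg (exec addEdge σ) 1 ≡ suc (toℕ e) × Inv (suc (toℕ e)) (exec addEdge σ)
    step e {σ} r≡e (H , ρ , m) = cong suc r≡e , H′ , ρ₄ , record { degrees = degrees′ ; neighbours = neighbours′ }
      where
      a b : ℕ
      a = eval (load (lit 3 ⊕ times 2 (var 1))) σ
      b = eval (load (lit 4 ⊕ times 2 (var 1))) σ
      a≡ : a ≡ toℕ (proj₁ (ends e))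
      a≡ = trans (cong (λ r → mem σ (3 + 2 * r)) r≡e)
                 (trans (intact ρ (<-trans (n<1+n _) (ends<inputLength e))) (proj₁ (input-ends e)))
      b≡ : b ≡ toℕ (proj₂ (ends e))
      b≡ = trans (cong (λ r → mem σ (4 + 2 * r)) r≡e)
                 (trans (intact ρ (ends<inputLength e)) (proj₂ (input-ends e)))
      σ₀ σ₁ σ₂ σ₃ : State
      σ₀ = ⟨ reg σ [ 2 ↦ a ] [ 3 ↦ b ] , mem σ ⟩
      σ₁ = exec (increase (var 2) deg (lit 1)) σ₀
      σ₂ = exec (increase (var 3) deg (lit 1)) σ₁
      σ₃ = exec (increase (var 2) nbr (var 3)) σ₂
      H′ : Fields
      H′ = adjust _+_ nbr b a (adjust _+_ nbr a b (adjust _+_ deg b 1 (adjust _+_ deg a 1 H)))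
      ρ₁ = represents-increase {σ₀} ρ (var 2) deg (lit 1)
      ρ₂ = represents-increase {σ₁} ρ₁ (var 3) deg (lit 1)
      ρ₃ = represents-increase {σ₂} ρ₂ (var 2) nbr (var 3)
      ρ₄ : Represents (mem (exec (increase (var 3) nbr (var 2)) σ₃)) H′
      ρ₄ = represents-increase {σ₃} ρ₃ (var 3) nbr (var 2)
      extend : ∀ (f : Fin size → Fin n → ℕ) w {x y z} → x ≡ sum (mask (below (toℕ e)) λ e → f e w) → y + z ≡ f e w →
               x + y + z ≡ sum (mask (below (suc (toℕ e))) λ e → f e w)
      extend f w {x} {y} {z} x≡ yz≡ = trans (+-assoc x y z) (trans (cong₂ _+_ x≡ yz≡) (sym (sum-mask-below (λ e → f e w) e)))
      degrees′ : ∀ w → H′ deg w ≡ degree (below (suc (toℕ e))) w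
      degrees′ w = extend incidence w (degrees m w) (cong₂ (λ a b → δ a (toℕ w) 1 + δ b (toℕ w) 1) a≡ b≡)
      neighbours′ : ∀ w → H′ nbr w ≡ neighbourSum (below (suc (toℕ e))) w
      neighbours′ w = extend opposite w (neighbours m w) (cong₂ (λ a b → δ a (toℕ w) b + δ b (toℕ w) a) a≡ b≡)
    start : Inv 0 σ
    start = (λ _ _ → 0) , represents-initial , record
      { degrees    = λ w → sym (sum-zero {size} _ λ _ → refl)
      ; neighbours = λ w → sym (sum-zero {size} _ λ _ → refl) }
    loop : Achieves readEdges σ (size * (testCost (var 1 ≺ E) + bound addEdge) + testCost (var 1 ≺ E)) (Inv size)
    loop = achieves-for Inv _ (λ {_} {σ} (_ , ρ , _) → eval-E {σ} (intact ρ)) step r≡0 start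

  -- Initial tables

  discrepancy : Fin n → Label → ℕ
  discrepancy v x = sum λ i → (terminal i v ∸ bit x i) + (bit x i ∸ terminal i v)

  initialCost : Fin n → Label → ℕ
  initialCost v x = if discrepancy v x ≡ᵇ 0 then 0 else suc k

  initialCost-own : ∀ {v x} → Own v x → initialCost v x ≡ 0
  initialCost-own {v} {x} own = cong (λ d → if d ≡ᵇ 0 then 0 else suc k) (sum-zero _ agree)
    where
    agree : ∀ i → (terminal i v ∸ bit x i) + (bit x i ∸ terminal i v) ≡ 0
    agree i rewrite own i | n∸n≡0 (terminal i v) = refl

  -- A cost of at most `k` is not the cap, so the discrepancy is 0. Then all its terms vanish, and
  -- two vanishing truncated differences give equality.
  initialCost≤k⇒own : ∀ {v x} → initialCost v x ≤ k → Own v x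
  initialCost≤k⇒own {v} {x} c≤k i = ≤-antisym
    (m∸n≡0⇒m≤n (m+n≡0⇒n≡0 (terminal i v ∸ bit x i) (gap i)))
    (m∸n≡0⇒m≤n (m+n≡0⇒m≡0 (terminal i v ∸ bit x i) (gap i)))
    where
    zero-discrepancy : ∀ d → (if d ≡ᵇ 0 then 0 else suc k) ≤ k → d ≡ 0
    zero-discrepancy zero    _    = refl
    zero-discrepancy (suc d) 1+k≤k = contradiction 1+k≤k 1+n≰n
    gap : ∀ i → (terminal i v ∸ bit x i) + (bit x i ∸ terminal i v) ≡ 0
    gap i = n≤0⇒n≡0 (≤-trans (≤-sum (λ i → (terminal i v ∸ bit x i) + (bit x i ∸ terminal i v)) i)
                             (≤-reflexive (zero-discrepancy (discrepancy v x) c≤k)))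

  eval-mismatch : ∀ {σ v} → Intact (mem σ) → reg σ 1 ≡ toℕ v → ∀ x → eval (mismatch x) σ ≡ discrepancy v x
  eval-mismatch {σ} {v} ι r≡v x =
    trans (eval-sumExp (λ i → (terminalExp i ⊖ lit (bit x i)) ⊕ (lit (bit x i) ⊖ terminalExp i)) σ)
          (sum-cong-≗ λ i → cong (λ t → (t ∸ bit x i) + (bit x i ∸ t)) (at i))
    where
    at : ∀ i → eval (terminalExp i) σ ≡ terminal i v
    at i = trans (cong (mem σ) (cong₂ (λ x y → 3 + x + y)
                   (trans (eval-times 2 E σ) (cong (2 *_) (eval-E {σ} ι)))
                   (cong₂ _+_ (trans (eval-times (toℕ i) N σ) (cong (toℕ i *_) (eval-N {σ} ι))) r≡v)))
           (trans (ι (terminal<inputLength i v)) (input-terminal i v))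

  setCost-effect : ∀ {σ v} → Intact (mem σ) → reg σ 1 ≡ toℕ v → ∀ x →
                   exec (setCost x) σ ≡ ⟨ reg σ , mem σ [ address (toℕ v) (tab x) ↦ initialCost v x ] ⟩
  setCost-effect {σ} {v} ι r≡v x = branch-elim (mismatch x ≈ lit 0)
    (store (slot (var 1) (tab x)) (lit 0)) (store (slot (var 1) (tab x)) ∞) σ Effect
    (λ d≡0 → written (trans (eval-slot {σ} ι (var 1) (tab x)) (cong (λ u → address u (tab x)) r≡v)) refl (cost≡ d≡0))
    (λ d≢0 → written (trans (eval-slot {σ} ι (var 1) (tab x)) (cong (λ u → address u (tab x)) r≡v))
                     (cong suc (eval-K {σ} ι)) (cost≡ d≢0))
    where
    Effect : State → Set
    Effect σ′ = σ′ ≡ ⟨ reg σ , mem σ [ address (toℕ v) (tab x) ↦ initialCost v x ] ⟩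
    cost≡ : ∀ {c} → (eval (mismatch x) σ ≡ᵇ 0) ≡ c → initialCost v x ≡ (if c then 0 else suc k)
    cost≡ eq = cong (if_then 0 else suc k) (trans (cong (_≡ᵇ 0) (sym (eval-mismatch {σ} ι r≡v x))) eq)
    written : ∀ {a y z} → a ≡ address (toℕ v) (tab x) → y ≡ z → initialCost v x ≡ z →
              Effect ⟨ reg σ , mem σ [ a ↦ y ] ⟩
    written refl refl refl = refl

  setCost-loopFree : LoopFree setCosts
  setCost-loopFree = each-loopFree setCost _ , _

  initialise-achieves : ∀ {σ} → (∃ λ H → Represents (mem σ) H × Matches (const true) H) →
    Achieves initialise σ (2 + (n * (testCost (var 1 ≺ N) + bound setCosts) + testCost (var 1 ≺ N)))
      (λ σ′ → ∃ λ H → Represents (mem σ′) H × Matches (const true) H × ∀ v x → H (tab x) v ≡ initialCost v x)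
  initialise-achieves {σ} (H₀ , ρ₀ , m₀) = achieves-⨾ (achieves-exec (1 ≔ lit 0) _ {Φ = _≡ exec (1 ≔ lit 0) σ} refl)
    λ { refl → record
      { halts  = halts loop
      ; timely = timely loop
      ; post   = let H , ρ , m , costs = post loop in H , ρ , m , λ v → costs v (toℕ<n v) } }
    where
    open Achieves
    Inv : ℕ → State → Set
    Inv i σ = ∃ λ H → Represents (mem σ) H × Matches (const true) H ×
                      (∀ v → toℕ v < i → ∀ x → H (tab x) v ≡ initialCost v x)
    step : ∀ u {σ} → reg σ 1 ≡ toℕ u → Inv (toℕ u) σ →
           reg (exec setCosts σ) 1 ≡ suc (toℕ u) × Inv (suc (toℕ u)) (exec setCosts σ)
    step u {σ} r≡u (H , ρ , m , costs) =
      cong suc (trans (cong (λ r → r 1) (proj₁ stored′)) r≡u) ,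
      overwrite (toℕ u) (initialCost u) H , proj₂ stored′ ,
      record { degrees = degrees m ; neighbours = neighbours m } , costs′
      where
      stored′ = each-store {σ} ρ {toℕ u} (initialCost u) setCost
        λ x {σ′} regs ι → setCost-effect {σ′} ι (trans (cong (λ r → r 1) regs) r≡u) x
      costs′ : ∀ v → toℕ v < suc (toℕ u) → ∀ x → overwrite (toℕ u) (initialCost u) H (tab x) v ≡ initialCost v x
      costs′ v v≤u x with toℕ u ≟ℕ toℕ v
      ... | yes u≡v with refl ← toℕ-injective u≡v rewrite ≡ᵇ-refl (toℕ u) = refl
      ... | no  u≢v rewrite ≢⇒≡ᵇ u≢v = costs v (≤∧≢⇒< (≤-pred v≤u) (u≢v ∘ sym)) x
    σ₀ : State
    σ₀ = exec (1 ≔ lit 0) σ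
    loop : Achieves (while (var 1 ≺ N) setCosts) σ₀ (n * (testCost (var 1 ≺ N) + bound setCosts) + testCost (var 1 ≺ N)) (Inv n)
    loop = achieves-for Inv setCost-loopFree (λ {_} {σ} (_ , ρ , _) → eval-N {σ} (intact ρ)) step refl (H₀ , ρ₀ , m₀ , λ _ ())

  -- Sum of minima and verdict

  module _ (H : Fields) where

    best : Fin n → ℕ
    best v = minimum (suc k) λ x → H (tab x) v

    sumBest-achieves : ∀ {σ} → Represents (mem σ) H →
      Achieves sumBest σ (4 + (n * (testCost (var 1 ≺ N) + bound addBest) + testCost (var 1 ≺ N)))
        (λ σ′ → Represents (mem σ′) H × reg σ′ 0 ≡ sum best)
    sumBest-achieves {σ} ρ₀ = achieves-⨾ (achieves-exec reset _ {Φ = _≡ exec reset σ} refl)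
      λ { refl → record
        { halts  = halts loop
        ; timely = timely loop
        ; post   = let ρ , r≡ = post loop in ρ , trans r≡ (mask-below-size best) } }
      where
      open Achieves
      reset : Program
      reset = 1 ≔ lit 0 ⨾ 0 ≔ lit 0
      Inv : ℕ → State → Set
      Inv i σ = Represents (mem σ) H × reg σ 0 ≡ sum (mask (below i) best)
      step : ∀ u {σ} → reg σ 1 ≡ toℕ u → Inv (toℕ u) σ →
             reg (exec addBest σ) 1 ≡ suc (toℕ u) × Inv (suc (toℕ u)) (exec addBest σ)
      step u {σ} r≡u (ρ , total≡) = cong suc r≡u , ρ , trans (cong₂ _+_ total≡ best≡) (sym (sum-mask-below best u))
        where
        best≡ : eval (least ∞ λ x → cell (var 1) (tab x)) σ ≡ best u
        best≡ = trans (eval-least ∞ (λ x → cell (var 1) (tab x)) σ)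
                      (minimum-cong (cong suc (eval-K {σ} (intact ρ))) λ x → eval-cell {σ} ρ (var 1) (tab x) r≡u)
      loop : Achieves (while (var 1 ≺ N) addBest) (exec reset σ)
                      (n * (testCost (var 1 ≺ N) + bound addBest) + testCost (var 1 ≺ N)) (Inv n)
      loop = achieves-for Inv _ (λ {_} {σ} (ρ , _) → eval-N {σ} (intact ρ)) step refl
        (ρ₀ , sym (sum-zero {n} _ λ _ → refl))

  verdict-achieves : ∀ {σ s} → Intact (mem σ) → reg σ 0 ≡ s → (YesInstance I → s ≤ k) → (s ≤ k → YesInstance I) →
    Achieves verdict σ (bound verdict)
      (λ σ′ → (reg σ′ 0 ≡ 1 × YesInstance I) ⊎ (reg σ′ 0 ≡ 0 × ¬ YesInstance I))
  verdict-achieves {σ} {s} ι refl yes⇒ ⇒yes = achieves-exec verdict _ (branch-elim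
    (var 0 ≺ ∞) (0 ≔ lit 1) (0 ≔ lit 0) σ Answer
    (λ t → inj₁ (refl , ⇒yes (≤-pred (subst (s <_) (cong suc (eval-K {σ} ι)) (<ᵇ⇒< _ _ (subst Bool.T (sym t) _))))))
    (λ f → inj₂ (refl , λ y → contradiction
       (trans (sym (<⇒<ᵇ≡true (subst (s <_) (sym (cong suc (eval-K {σ} ι))) (s≤s (yes⇒ y))))) f) λ ())))
    where
    Answer : State → Set
    Answer σ′ = (reg σ′ 0 ≡ 1 × YesInstance I) ⊎ (reg σ′ 0 ≡ 0 × ¬ YesInstance I)

  relaxed-≗ : ∀ {f g h h′} → Relaxed k f g h → (∀ c → h′ c ≡ h c) → Relaxed k f g h′
  relaxed-≗ {f} {g} {h} {h′} r h≡ = record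
    { below-merge = λ {_} {_} {c} μ → subst (_≤ _) (sym (h≡ c)) (below-merge μ)
    ; below-cut   = λ b c → subst (_≤ _) (sym (h≡ c)) (below-cut b c)
    ; attained    = λ c h′≤k → subst (λ y → (∃₂ λ a b → Merge a b c × y ≡ f a + g b) ⊎ (∃ λ b → y ≡ f c + suc (g b)))
                                     (sym (h≡ c)) (attained c (subst (_≤ k) (h≡ c) h′≤k)) }
    where open Relaxed r

  -- Effect of one pruning on the memory

  module _ {σ : State} {H : Fields} {A : Fin size → Bool} {u : Fin n}
           (ρ : Represents (mem σ) H) (m : Matches A H) (r≡u : reg σ 2 ≡ toℕ u) (ℓ : Leaf A u) where
    open Leaf ℓ renaming (edge to e; parent to p)

    private
      u≢p : toℕ u ≢ toℕ p
      u≢p = joins-distinct joins ∘ toℕ-injective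

    parentCost : Label → ℕ
    parentCost = relax k (λ x → H (tab x) p) (λ x → H (tab x) u)

    prunedFields : Fields
    prunedFields =
      adjust _∸_ nbr (toℕ p) (toℕ u) (adjust _∸_ nbr (toℕ u) (toℕ p)
        (adjust _∸_ deg (toℕ p) 1 (adjust _∸_ deg (toℕ u) 1
          (overwrite (toℕ u) (const 0) (overwrite (toℕ p) parentCost H)))))

    private
      -- Nothing is truncated, because the contribution `y + z` of the removed edge is a summand of
      -- `x`.
      shrink : ∀ (f : Fin size → Fin n → ℕ) w {x} y z → x ≡ sum (mask A λ e → f e w) → f e w ≡ y + z →
               x ∸ y ∸ z ≡ sum (mask (A ─ e) λ e → f e w)
      shrink f w {x} y z x≡ yz≡ = begin
        x ∸ y ∸ z                                             ≡⟨ ∸-+-assoc x y z ⟩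
        x ∸ (y + z)                                           ≡⟨ cong₂ _∸_ (trans x≡ (sum-mask-─ (λ e → f e w) alive)) (sym yz≡) ⟩
        sum (mask (A ─ e) λ e → f e w) + f e w ∸ f e w        ≡⟨ m+n∸n≡m _ (f e w) ⟩
        sum (mask (A ─ e) λ e → f e w)                        ∎
        where open ≡-Reasoning

    pruned-matches : Matches (A ─ e) prunedFields
    pruned-matches = record
      { degrees    = λ w → shrink incidence w (δ (toℕ u) (toℕ w) 1) (δ (toℕ p) (toℕ w) 1) (degrees m w) (joins-incidence joins w)
      ; neighbours = λ w → shrink opposite w (δ (toℕ u) (toℕ w) (toℕ p)) (δ (toℕ p) (toℕ w) (toℕ u))
                                  (neighbours m w) (joins-opposite joins w) }

    private
      vanish : ∀ x → prunedFields (tab x) u ≡ 0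
      vanish x rewrite ≡ᵇ-refl (toℕ u) = refl

      relaxed : Relaxed k (λ x → H (tab x) p) (λ x → H (tab x) u) (λ x → prunedFields (tab x) p)
      relaxed = relaxed-≗ (relax-relaxed k _ _) parent≡
        where
        parent≡ : ∀ c → prunedFields (tab c) p ≡ parentCost c
        parent≡ c rewrite ≢⇒≡ᵇ u≢p | ≡ᵇ-refl (toℕ p) = refl

      other : ∀ w → w ≢ u → w ≢ p → ∀ x → prunedFields (tab x) w ≡ H (tab x) w
      other w w≢u w≢p x
        rewrite ≢⇒≡ᵇ (w≢u ∘ sym ∘ toℕ-injective {i = u} {w}) | ≢⇒≡ᵇ (w≢p ∘ sym ∘ toℕ-injective {i = p} {w}) = refl

    pruned-sound : Solution k (A ─ e) (λ v x → prunedFields (tab x) v) → Solution k A (λ v x → H (tab x) v)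
    pruned-sound = prune⇐ ℓ vanish relaxed other

    pruned-complete : Solution k A (λ v x → H (tab x) v) → Solution k (A ─ e) (λ v x → prunedFields (tab x) v)
    pruned-complete = prune⇒ ℓ vanish relaxed other

    pruned-degree-≤ : ∀ w → prunedFields deg w ≤ H deg w
    pruned-degree-≤ w = ≤-trans (m∸n≤m _ (δ (toℕ p) (toℕ w) 1)) (m∸n≤m _ (δ (toℕ u) (toℕ w) 1))

    pruned-degree-other : ∀ w → w ≢ u → w ≢ p → prunedFields deg w ≡ H deg w
    pruned-degree-other w w≢u w≢p =
      cong₂ (λ x y → H deg w ∸ x ∸ y) (δ-diff 1 (w≢u ∘ sym ∘ toℕ-injective)) (δ-diff 1 (w≢p ∘ sym ∘ toℕ-injective))

    pruned-degree-leaf : H deg u ≡ 1 → prunedFields deg u ≡ 0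
    pruned-degree-leaf deg≡1 =
      cong₂ _∸_ (cong₂ _∸_ deg≡1 (δ-same (toℕ u) 1)) (δ-diff 1 (u≢p ∘ sym))

    private
      σ₁ σ₂ σ₃ σ₄ σ₅ σ₆ σ₇ : State
      σ₁ = exec (3 ≔ cell (var 2) nbr) σ
      σ₂ = exec (each relaxParent) σ₁
      σ₃ = exec (each setParent) σ₂
      σ₄ = exec (each clearLeaf) σ₃
      σ₅ = exec (decrease (var 2) deg (lit 1)) σ₄
      σ₆ = exec (decrease (var 3) deg (lit 1)) σ₅
      σ₇ = exec (decrease (var 2) nbr (var 3)) σ₆

      r₃≡p : reg σ₁ 3 ≡ toℕ p
      r₃≡p = trans (eval-cell {σ} ρ (var 2) nbr r≡u) (trans (neighbours m u) pointer)

      -- The bound 4 is where `scratch` begins: the registers below it hold the counter and the two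
      -- ends of the edge, and must survive.
      Scratched : ℕ → State → Set
      Scratched i σ′ = mem σ′ ≡ mem σ × (∀ {r} → r < 4 → reg σ′ r ≡ reg σ₁ r) ×
                       (∀ x → toℕ x < i → reg σ′ (scratch x) ≡ parentCost x)

      scratched : Scratched (2 ^ q) σ₂
      scratched = each-invariant relaxParent Scratched step {σ₁} (refl , (λ _ → refl) , λ _ ())
        where
        step : ∀ x {σ′} → Scratched (toℕ x) σ′ → Scratched (suc (toℕ x)) (exec (relaxParent x) σ′)
        step x {σ′} (mem≡ , regs , costs) = mem≡ ,
          (λ {r} r<4 → trans (↦-other (reg σ′) {scratch x} {r} _ λ eq → <⇒≱ r<4 (≤-trans (m≤m+n 4 (toℕ x)) (≤-reflexive eq)))
                             (regs r<4)) ,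
          costs′
          where
          ρ′ : Represents (mem σ′) H
          ρ′ = subst (λ μ → Represents μ H) (sym mem≡) ρ
          value : eval (relaxExp (λ y → cell (var 3) (tab y)) (λ y → cell (var 2) (tab y)) x) σ′ ≡ parentCost x
          value = eval-relaxExp (λ y → cell (var 3) (tab y)) (λ y → cell (var 2) (tab y)) σ′ (eval-K {σ′} (intact ρ′))
            (λ y → eval-cell {σ′} ρ′ (var 3) (tab y) (trans (regs (s≤s (s≤s (s≤s (s≤s z≤n))))) r₃≡p))
            (λ y → eval-cell {σ′} ρ′ (var 2) (tab y) (trans (regs (s≤s (s≤s (s≤s z≤n)))) r≡u)) x
          costs′ : ∀ y → toℕ y < suc (toℕ x) → reg (exec (relaxParent x) σ′) (scratch y) ≡ parentCost y
          costs′ y y≤x with toℕ x ≟ℕ toℕ y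
          ... | yes x≡y with refl ← toℕ-injective x≡y = trans (↦-same (reg σ′) {scratch x} _ refl) value
          ... | no  x≢y = trans (↦-other (reg σ′) {scratch x} {scratch y} _ (x≢y ∘ +-cancelˡ-≡ 4 _ _))
                                (costs y (≤∧≢⇒< (≤-pred y≤x) (x≢y ∘ sym)))

      store-effect : ∀ {v} {e : Exp} {u′ y} (x : Label) {σ′} → Intact (mem σ′) → eval v σ′ ≡ u′ → eval e σ′ ≡ y →
                     exec (store (slot v (tab x)) e) σ′ ≡ ⟨ reg σ′ , mem σ′ [ address u′ (tab x) ↦ y ] ⟩
      store-effect {v} x {σ′} ι refl refl = cong (λ a → ⟨ reg σ′ , mem σ′ [ a ↦ _ ] ⟩) (eval-slot {σ′} ι v (tab x))

      low-regs : ∀ {r} → r < 4 → reg σ₂ r ≡ reg σ₁ r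
      low-regs = proj₁ (proj₂ scratched)

      parentSet : reg σ₃ ≡ reg σ₂ × Represents (mem σ₃) (overwrite (toℕ p) parentCost H)
      parentSet = each-store {σ₂} (subst (λ μ → Represents μ H) (sym (proj₁ scratched)) ρ) parentCost setParent
        λ x {σ′} regs ι → store-effect {var 3} {var (scratch x)} x {σ′} ι
          (trans (cong (λ f → f 3) regs) (trans (low-regs (s≤s (s≤s (s≤s (s≤s z≤n))))) r₃≡p))
          (trans (cong (λ f → f (scratch x)) regs) (proj₂ (proj₂ scratched) x (toℕ<n x)))

      leafCleared : reg σ₄ ≡ reg σ₃ × Represents (mem σ₄) (overwrite (toℕ u) (const 0) (overwrite (toℕ p) parentCost H))
      leafCleared = each-store {σ₃} (proj₂ parentSet) (const 0) clearLeaf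
        λ x {σ′} regs ι → store-effect {var 2} {lit 0} x {σ′} ι
          (trans (cong (λ f → f 2) (trans regs (proj₁ parentSet))) (trans (low-regs (s≤s (s≤s (s≤s z≤n)))) r≡u)) refl

      regs₄ : ∀ {r} → r < 4 → reg σ₄ r ≡ reg σ₁ r
      regs₄ {r} r<4 = trans (cong (λ f → f r) (trans (proj₁ leafCleared) (proj₁ parentSet))) (low-regs r<4)

      -- Leaf and parent are still named by register contents here; `prune-effect` replaces these by
      -- `u` and `p`.
      ρ₇ : Represents (mem (exec (decrease (var 3) nbr (var 2)) σ₇))
             (adjust _∸_ nbr (reg σ₄ 3) (reg σ₄ 2) (adjust _∸_ nbr (reg σ₄ 2) (reg σ₄ 3)
               (adjust _∸_ deg (reg σ₄ 3) 1 (adjust _∸_ deg (reg σ₄ 2) 1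
                 (overwrite (toℕ u) (const 0) (overwrite (toℕ p) parentCost H))))))
      ρ₇ = represents-decrease {σ₇} (represents-decrease {σ₆} (represents-decrease {σ₅}
             (represents-decrease {σ₄} (proj₂ leafCleared) (var 2) deg (lit 1))
             (var 3) deg (lit 1)) (var 2) nbr (var 3)) (var 3) nbr (var 2)

    prune-effect : reg (exec prune σ) 1 ≡ reg σ 1 × reg (exec prune σ) 2 ≡ toℕ p ×
                   Represents (mem (exec prune σ)) prunedFields
    prune-effect = regs₄ (s≤s (s≤s z≤n)) , r₃ , subst₂ (λ a b → Represents (mem (exec prune σ))
        (adjust _∸_ nbr a b (adjust _∸_ nbr b a (adjust _∸_ deg a 1 (adjust _∸_ deg b 1
          (overwrite (toℕ u) (const 0) (overwrite (toℕ p) parentCost H))))))) r₃ r₂ ρ₇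
      where
      r₃ : reg σ₄ 3 ≡ toℕ p
      r₃ = trans (regs₄ (s≤s (s≤s (s≤s (s≤s z≤n))))) r₃≡p
      r₂ : reg σ₄ 2 ≡ toℕ u
      r₂ = trans (regs₄ (s≤s (s≤s (s≤s z≤n)))) r≡u

  -- The scan for leaves

  isolated : Fields → Fin n → Bool
  isolated H w = H deg w ≡ᵇ 0

  -- The condition edges≤ holds because every pruning isolates a vertex.  At the end it yields
  -- size ≤ n, without which the time to read the edges is not O(n).
  record Pruning (σ : State) (μ : ℕ) : Set where
    field
      fields   : Fields
      alive    : Fin size → Bool
      rep      : Represents (mem σ) fields
      matches  : Matches alive fields
      sound    : Solution k alive (λ v x → fields (tab x) v) → YesInstance I
      complete : YesInstance I → Solution k alive (λ v x → fields (tab x) v)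
      inside   : reg σ 1 < n → reg σ 2 < n
      outside  : n ≤ reg σ 1 → n ≤ reg σ 2
      passed   : ∀ w → toℕ w ≤ reg σ 1 → toℕ w ≢ reg σ 2 → fields deg w ≢ 1
      edges≤   : size ≤ count alive + count (isolated fields)
      measure  : μ ≡ n ∸ reg σ 1 + count alive

  -- Only two degrees change. That of `u` falls to 0, and `p` becomes the current vertex, which
  -- `passed` exempts; so no scanned vertex needs a second look. One alive edge fewer lowers the
  -- measure.
  prune-step : ∀ {σ μ} → Pruning σ μ → reg σ 1 < n → eval (cell (var 2) deg) σ ≡ 1 →
               ∃ λ μ′ → μ′ < μ × Pruning (exec prune σ) μ′
  prune-step {σ} {μ} inv v<n deg≡1 = n ∸ reg σ 1 + count (alive ─ e) , smaller , record
    { fields   = H′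
    ; alive    = alive ─ e
    ; rep      = proj₂ (proj₂ effect)
    ; matches  = pruned-matches {σ} rep matches r≡u ℓ
    ; sound    = sound ∘ pruned-sound {σ} rep matches r≡u ℓ
    ; complete = pruned-complete {σ} rep matches r≡u ℓ ∘ complete
    ; inside   = λ _ → subst (_< n) (sym r₂) (toℕ<n p)
    ; outside  = λ n≤v → contradiction v<n (≤⇒≯ (≤-trans n≤v (≤-reflexive r₁)))
    ; passed   = λ w w≤v w≢p → passed′ w (≤-trans w≤v (≤-reflexive r₁)) λ w≡p → w≢p (trans w≡p (sym r₂))
    ; edges≤   = edges′
    ; measure  = cong (λ i → n ∸ i + count (alive ─ e)) (sym r₁) }
    where
    open Pruning inv
    u : Fin n
    u = fromℕ< (inside v<n)
    r≡u : reg σ 2 ≡ toℕ u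
    r≡u = sym (toℕ-fromℕ< (inside v<n))
    degu≡1 : fields deg u ≡ 1
    degu≡1 = trans (sym (eval-cell {σ} rep (var 2) deg r≡u)) deg≡1
    ℓ : Leaf alive u
    ℓ = leaf (trans (sym (degrees matches u)) degu≡1)
    open Leaf ℓ using (joins) renaming (edge to e; parent to p; alive to e-alive)
    H′ : Fields
    H′ = prunedFields {σ} rep matches r≡u ℓ
    effect : reg (exec prune σ) 1 ≡ reg σ 1 × reg (exec prune σ) 2 ≡ toℕ p × Represents (mem (exec prune σ)) H′
    effect = prune-effect {σ} rep matches r≡u ℓ
    r₁ : reg (exec prune σ) 1 ≡ reg σ 1
    r₁ = proj₁ effect
    r₂ : reg (exec prune σ) 2 ≡ toℕ p
    r₂ = proj₁ (proj₂ effect)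
    deg′u≡0 : H′ deg u ≡ 0
    deg′u≡0 = pruned-degree-leaf {σ} rep matches r≡u ℓ degu≡1
    passed′ : ∀ w → toℕ w ≤ reg σ 1 → toℕ w ≢ toℕ p → H′ deg w ≢ 1
    passed′ w w≤v w≢p with toℕ w ≟ℕ toℕ u
    ... | yes w≡u with refl ← toℕ-injective w≡u = λ eq → contradiction (trans (sym deg′u≡0) eq) λ ()
    ... | no  w≢u = λ eq → passed w w≤v (w≢u ∘ λ w≡ → trans w≡ r≡u)
          (trans (sym (pruned-degree-other {σ} rep matches r≡u ℓ w (w≢u ∘ cong toℕ) (w≢p ∘ cong toℕ))) eq)
    count≡ : count alive ≡ count (alive ─ e) + 1
    count≡ = sum-mask-─ {A = alive} {e} (const 1) e-alive
    isolated-≤ : ∀ w → mask (isolated fields) (const 1) w ≤ mask (isolated H′) (const 1) w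
    isolated-≤ w with fields deg w | H′ deg w | pruned-degree-≤ {σ} rep matches r≡u ℓ w
    ... | zero  | zero | _ = ≤-refl
    ... | suc _ | _    | _ = z≤n
    -- Degrees never grow, so isolated vertices stay isolated, and `u` joins them.
    isolated-< : count (isolated fields) < count (isolated H′)
    isolated-< = sum-mono-< isolated-≤ u (subst₂ (λ x y → indicator (x ≡ᵇ 0) < indicator (y ≡ᵇ 0))
                   (sym degu≡1) (sym deg′u≡0) (s≤s z≤n))
    edges′ : size ≤ count (alive ─ e) + count (isolated H′)
    edges′ = begin
      size                                                 ≤⟨ edges≤ ⟩
      count alive + count (isolated fields)                ≡⟨ cong (_+ count (isolated fields)) count≡ ⟩
      count (alive ─ e) + 1 + count (isolated fields)      ≡⟨ +-assoc (count (alive ─ e)) 1 _ ⟩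
      count (alive ─ e) + suc (count (isolated fields))    ≤⟨ +-monoʳ-≤ (count (alive ─ e)) isolated-< ⟩
      count (alive ─ e) + count (isolated H′)              ∎
      where open ≤-Reasoning
    smaller : n ∸ reg σ 1 + count (alive ─ e) < μ
    smaller = ≤-trans (+-monoʳ-< (n ∸ reg σ 1) (≤-reflexive (trans (+-comm 1 _) (sym count≡)))) (≤-reflexive (sym measure))

  -- The failed test shows that the exempt vertex is no leaf either, so `passed` holds for
  -- everything scanned so far, and the exemption moves on to the next vertex.
  advance-step : ∀ {σ μ} → Pruning σ μ → reg σ 1 < n → eval (cell (var 2) deg) σ ≢ 1 →
                 ∃ λ μ′ → μ′ < μ × Pruning (exec advance σ) μ′
  advance-step {σ} {μ} inv v<n deg≢1 = n ∸ suc (reg σ 1) + count alive , smaller , record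
    { fields   = fields
    ; alive    = alive
    ; rep      = rep
    ; matches  = matches
    ; sound    = sound
    ; complete = complete
    ; inside   = λ v<n → v<n
    ; outside  = λ n≤v → n≤v
    ; passed   = λ w w≤ w≢ → passed′ w (≤-pred (≤∧≢⇒< w≤ w≢))
    ; edges≤   = edges≤
    ; measure  = refl }
    where
    open Pruning inv
    smaller : n ∸ suc (reg σ 1) + count alive < μ
    smaller = ≤-trans (+-monoˡ-< (count alive) (∸-monoʳ-< (n<1+n (reg σ 1)) v<n)) (≤-reflexive (sym measure))
    passed′ : ∀ w → toℕ w ≤ reg σ 1 → fields deg w ≢ 1
    passed′ w w≤v with toℕ w ≟ℕ reg σ 2
    ... | yes w≡u = λ eq → deg≢1 (trans (eval-cell {σ} rep (var 2) deg (sym w≡u)) eq)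
    ... | no  w≢u = passed w w≤v w≢u

  Pruned : State → Set
  Pruned σ = ∃₂ λ H A → Represents (mem σ) H × (∀ e → A e ≡ false) × size ≤ n ×
    (Solution k A (λ v x → H (tab x) v) → YesInstance I) × (YesInstance I → Solution k A (λ v x → H (tab x) v))

  pruneLeaves-achieves : ∀ {σ} →
    (∃ λ H → Represents (mem σ) H × Matches (const true) H × ∀ v x → H (tab x) v ≡ initialCost v x) →
    Achieves pruneLeaves σ
      (4 + ((n + size) * (testCost (var 1 ≺ N) + bound pruneOrAdvance) + testCost (var 1 ≺ N))) Pruned
  pruneLeaves-achieves {σ} (H₀ , ρ₀ , m₀ , costs) = achieves-⨾ (achieves-exec reset _ {Φ = _≡ exec reset σ} refl)
    λ { refl → record
      { halts  = halts loop
      ; timely = timely loop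
      ; post   = let stop , _ , inv = post loop in done stop inv } }
    where
    open Achieves
    reset : Program
    reset = 1 ≔ lit 0 ⨾ 2 ≔ lit 0
    step : ∀ {σ μ} → Pruning σ μ → test (var 1 ≺ N) σ ≡ true → ∃ λ μ′ → μ′ < μ × Pruning (exec pruneOrAdvance σ) μ′
    step {σ} {μ} inv continue = branch-elim (cell (var 2) deg ≈ lit 1) prune advance σ
      (λ σ′ → ∃ λ μ′ → μ′ < μ × Pruning σ′ μ′)
      (λ t → prune-step inv v<n (≡ᵇ⇒≡ _ 1 (subst Bool.T (sym t) _)))
      (λ f → advance-step inv v<n λ eq → contradiction (trans (sym f) (cong (_≡ᵇ 1) eq)) λ ())
      where
      v<n : reg σ 1 < n
      v<n = subst (reg σ 1 <_) (eval-N {σ} (intact (Pruning.rep inv))) (<ᵇ⇒< _ _ (subst Bool.T (sym continue) _))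
    count-all : count {size} (const true) ≡ size
    count-all = sum-ones size
      where
      sum-ones : ∀ m → sum {m} (const 1) ≡ m
      sum-ones zero    = refl
      sum-ones (suc m) = cong suc (sum-ones m)
    initial-own : ∀ {v x} → Own v x → H₀ (tab x) v ≡ 0
    initial-own {v} {x} own = trans (costs v x) (initialCost-own own)
    initial-forced : ∀ {v x} → H₀ (tab x) v ≤ k → Own v x
    initial-forced {v} {x} ≤k = initialCost≤k⇒own (subst (_≤ k) (costs v x) ≤k)
    start : Pruning (exec reset σ) (n + size)
    start = record
      { fields   = H₀
      ; alive    = const true
      ; rep      = ρ₀
      ; matches  = m₀
      ; sound    = solution⇒yes _ initial-own initial-forced
      ; complete = yes⇒solution _ initial-own initial-forced
      ; inside   = λ 0<n → 0<n
      ; outside  = λ n≤0 → n≤0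
      ; passed   = λ w w≤0 w≢0 → contradiction (n≤0⇒n≡0 w≤0) w≢0
      ; edges≤   = ≤-trans (≤-reflexive (sym count-all)) (m≤m+n _ _)
      ; measure  = cong (n +_) (sym count-all) }
    loop : Achieves (while (var 1 ≺ N) pruneOrAdvance) (exec reset σ)
             ((n + size) * (testCost (var 1 ≺ N) + bound pruneOrAdvance) + testCost (var 1 ≺ N))
             (λ σ′ → test (var 1 ≺ N) σ′ ≡ false × ∃ (Pruning σ′))
    loop = achieves-while Pruning (prune-loopFree , _) step start
    done : ∀ {σ μ} → test (var 1 ≺ N) σ ≡ false → Pruning σ μ → Pruned σ
    done {σ} stop inv = fields , alive , rep , edgeless , size≤n , sound , complete
      where
      open Pruning inv
      n≤v : n ≤ reg σ 1
      n≤v = ≮⇒≥ λ v<n → contradiction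
        (trans (sym (<⇒<ᵇ≡true (subst (reg σ 1 <_) (sym (eval-N {σ} (intact rep))) v<n))) stop) λ ()
      -- After the scan `outside` puts register 2 beyond all vertices, which voids the exemption in
      -- `passed`: no vertex is a leaf.
      edgeless : ∀ e → alive e ≡ false
      edgeless = leafless⇒edgeless (IsTree.acyclic isTree) λ w deg≡1 → passed w
        (≤-trans (<⇒≤ (toℕ<n w)) n≤v) (<⇒≢ (≤-trans (toℕ<n w) (outside n≤v))) (trans (degrees matches w) deg≡1)
      size≤n : size ≤ n
      size≤n = begin
        size                                    ≤⟨ edges≤ ⟩
        count alive + count (isolated fields)   ≡⟨ cong (_+ count (isolated fields))
                                                     (sum-zero _ λ e → cong indicator (edgeless e)) ⟩
        count (isolated fields)                 ≤⟨ sum-≤-size _ (λ w → indicator≤1 (isolated fields w)) ⟩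
        n                                       ∎
        where
        open ≤-Reasoning
        indicator≤1 : ∀ b → indicator b ≤ 1
        indicator≤1 true  = ≤-refl
        indicator≤1 false = z≤n

  -- Linear time and the final assembly

  total-time : size ≤ n →
    size * (testCost (var 1 ≺ E) + bound addEdge) + testCost (var 1 ≺ E) +
    (2 + (n * (testCost (var 1 ≺ N) + bound setCosts) + testCost (var 1 ≺ N)) +
    (4 + ((n + size) * (testCost (var 1 ≺ N) + bound pruneOrAdvance) + testCost (var 1 ≺ N)) +
    (4 + (n * (testCost (var 1 ≺ N) + bound addBest) + testCost (var 1 ≺ N)) + bound verdict)))
    ≤ timeConstant * n
  total-time size≤n =
    add (loopConstant 1 E addEdge) (loop 1 E addEdge size≤1n) $
    add (2 + loopConstant 1 N setCosts) (add 2 {loopConstant 1 N setCosts} (constant 2) (loop 1 N setCosts n≤1n)) $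
    add (4 + loopConstant 2 N pruneOrAdvance) (add 4 {loopConstant 2 N pruneOrAdvance} (constant 4)
                                                 (loop 2 N pruneOrAdvance (+-monoʳ-≤ n size≤1n))) $
    add (4 + loopConstant 1 N addBest) (add 4 {loopConstant 1 N addBest} (constant 4) (loop 1 N addBest n≤1n))
      (constant (bound verdict))
    where
    n≤1n : n ≤ 1 * n
    n≤1n = ≤-reflexive (sym (*-identityˡ n))
    size≤1n : size ≤ 1 * n
    size≤1n = ≤-trans size≤n n≤1n
    -- A tree has a vertex, so additive constants are absorbed by the factor `n`.
    constant : ∀ c → c ≤ c * n
    constant c = ≤-trans (≤-reflexive (sym (*-identityʳ c))) (*-monoʳ-≤ c (IsTree.nonempty isTree))
    add : ∀ x {y a b} → a ≤ x * n → b ≤ y * n → a + b ≤ (x + y) * n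
    add x {y} a≤ b≤ = ≤-trans (+-mono-≤ a≤ b≤) (≤-reflexive (sym (*-distribʳ-+ n x y)))
    loop : ∀ d limit P {m} → m ≤ d * n →
           m * (testCost (var 1 ≺ limit) + bound P) + testCost (var 1 ≺ limit) ≤ loopConstant d limit P * n
    loop d limit P {m} m≤ = add (d * c) (begin
      m * c        ≤⟨ *-monoˡ-≤ c m≤ ⟩
      d * n * c    ≡⟨ *-assoc d n c ⟩
      d * (n * c)  ≡⟨ cong (d *_) (*-comm n c) ⟩
      d * (c * n)  ≡⟨ *-assoc d c n ⟨
      d * c * n    ∎) (constant (testCost (var 1 ≺ limit)))
      where
      open ≤-Reasoning
      c = testCost (var 1 ≺ limit) + bound P

  program-decides : Decides program (encode I) (YesInstance I) (timeConstant * n)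
  program-decides = record
    { time   = _
    ; final  = _
    ; halts  = halts run
    ; timely = ≤-trans (timely run) (total-time (proj₁ (post run)))
    ; answer = proj₂ (post run) }
    where
    open Achieves
    -- `size ≤ n` is carried along as a postcondition: it becomes known only after pruning, but is
    -- needed to bound the time already spent on reading the edges.
    Answer : State → Set
    Answer σ′ = size ≤ n × ((reg σ′ 0 ≡ 1 × YesInstance I) ⊎ (reg σ′ 0 ≡ 0 × ¬ YesInstance I))
    judge : ∀ {σ} → Pruned σ → Achieves (sumBest ⨾ verdict) σ
      (4 + (n * (testCost (var 1 ≺ N) + bound addBest) + testCost (var 1 ≺ N)) + bound verdict) Answer
    judge (H , A , ρ , edgeless , size≤n , sound , complete) = achieves-⨾ (sumBest-achieves H ρ) λ (ρ′ , total≡) →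
      weaken (verdict-achieves (intact ρ′) total≡
        (λ y → solution⇒best (best H) lower attained (complete y))
        (λ ≤k → sound (best⇒solution (best H) lower attained edgeless ≤k)))
      where
      weaken : ∀ {σ} → Achieves verdict σ (bound verdict)
                 (λ σ′ → (reg σ′ 0 ≡ 1 × YesInstance I) ⊎ (reg σ′ 0 ≡ 0 × ¬ YesInstance I)) →
               Achieves verdict σ (bound verdict) Answer
      weaken a = record { halts = halts a ; timely = timely a ; post = size≤n , post a }
      lower : ∀ v x → best H v ≤ H (tab x) v
      lower v = minimum-≤ (suc k) (λ x → H (tab x) v)
      attained : ∀ v → best H v ≤ k → ∃ λ x → best H v ≡ H (tab x) v
      attained v ≤k with minimum-attained (suc k) (λ x → H (tab x) v)
      ... | inj₁ eq = contradiction (subst (_≤ k) eq ≤k) 1+n≰n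
      ... | inj₂ x  = x
    run = achieves-⨾ {Φ = λ _ → _} (readEdges-achieves {initial (encode I)} refl refl) λ p →
          achieves-⨾ (initialise-achieves p) λ p →
          achieves-⨾ (pruneLeaves-achieves p) judge

theorem5p2 : ∀ (q : ℕ) → 1 ≤ q →
    Σ Program λ P → ∃ λ (c : ℕ) →
    ∀ {n : ℕ} (I : GMWCT q n) → Decides P (encode I) (YesInstance I) (c * n)
theorem5p2 q 1≤q = Algorithm.program q , Algorithm.timeConstant q , Verification.program-decides
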